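{- With the notation $\mathrm{HML}^d(\mathcal{C})$ for the fragment of $\mu\mathrm{HML}^d$ using the constructs in $\mathcal{C}$ (and $\mathsf{tt}$), the following chain of strict expressiveness inclusions holds: $$\mathrm{HML}^d(\exists,\langle\,\rangle,\vee,\textsc{det})\sqsubsetneq\mathrm{HML}^d(\min,\exists,\langle\,\rangle,\vee,\textsc{det})\sqsubsetneq\mathrm{HML}^d(\min,\exists,\langle\,\rangle,\vee,\textsc{match})\sqsubsetneq\mathrm{HML}^d(\min,\exists,\langle\,\rangle,\vee)$$ $$\sqsubsetneq\mathrm{HML}^d(\min,\exists,\langle\,\rangle,\vee,\wedge)\sqsubsetneq\mathrm{HML}^d(\min,\max,\exists,\forall,\langle\,\rangle,[\,],\vee,\wedge)=\mu\mathrm{HML}^d.$$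
   Context: **Data and traces.** Fix a countably infinite set $\mathbb{D}$ (data values) whose only predicate is equality. $\mathrm{Trc}=\mathbb{D}^\omega$. **Logic $\mu\mathrm{HML}^d$.** Let $\mathrm{DVar}$ and $\mathrm{FVar}$ be countably infinite sets of data variables $x$ and recursion variables $X$; $\star\notin\mathrm{DVar}$ is a placeholder for the current data value. Constraint expressions: $b::=\mathsf{true}\mid e=f\mid\neg b\mid b\wedge b$, with $e,f\in\mathrm{DVar}\cup\{\star\}$. Formulae: $\varphi::=\mathsf{tt}\mid\mathsf{ff}\mid\langle b\rangle\varphi\mid[b]\varphi\mid\exists x.\varphi\mid\forall x.\varphi\mid\varphi\vee\varphi\mid\varphi\wedge\varphi\mid\min X.\varphi\mid\max X.\varphi\mid X$. A data environment $\delta$ is a finite partial function $\mathrm{DVar}\rightharpoonup\mathbb{D}$; data interpretations $F$ map data environments to subsets of $\mathrm{Trc}$ (ordered pointwise by inclusion); trace environments $\rho$ map recursion variables to data interpretations. Semantics: $\mathsf{tt}\mapsto\mathrm{Trc}$; $\mathsf{ff}\mapsto\varnothing$; $[\![X,\rho,\delta]\!]=\rho(X)(\delta)$; $[\![\langle b\rangle\varphi,\rho,\delta]\!]=\{du\mid b\text{ true under }\delta[\star\mapsto d]\text{ and }u\in[\![\varphi,\rho,\delta]\!]\}$; $[\![[b]\varphi,\rho,\delta]\!]=\{du\mid b\text{ true under }\delta[\star\mapsto d]\text{ implies }u\in[\![\varphi,\rho,\delta]\!]\}$; $[\![\exists x.\varphi,\rho,\delta]\!]=\bigcup_{d}[\![\varphi,\rho,\delta[x\mapsto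 d]]\!]$; $[\![\forall x.\varphi,\rho,\delta]\!]=\bigcap_{d}[\![\varphi,\rho,\delta[x\mapsto d]]\!]$; $\vee,\wedge$ are union, intersection; $[\![\min X.\varphi,\rho,\delta]\!]$ (resp. $\max$) is the value at $\delta$ of the least (resp. greatest) fixed point of $F\mapsto\lambda\delta'.[\![\varphi,\rho[X\mapsto F],\delta']\!]$. For closed $\varphi$ write $[\![\varphi]\!]$. Standing assumption: each occurrence of a recursion variable is in the scope of a modality inside its defining fixed-point formula. **Fragments.** $\mathrm{HML}^d(\mathcal{C})$ is the set of closed formulae built from $\mathsf{tt}$ (and $\mathsf{ff}$ in the full logic) using only the constructs in $\mathcal{C}$ (recursion variables being available when a fixed-point operator is). Additional restrictions: $\textsc{match}$: every occurrence of $\exists$ is of the form $\exists x.\langle x=\star\wedge b\rangle\varphi$. $\textsc{det}$: the restriction $\textsc{match}$ holds and additionally all disjunctions are of the form $\bigvee_{i\in I}\exists x.\langle\star=x\wedge b_i\rangle\varphi_i$ with $I$ finite and $b_i\wedge b_j$ unsatisfiable for all $i\ne j$ in $I$. **Expressiveness.** For classes of formulae $\mathcal{L}_1,\mathcal{L}_2$: $\mathcal{L}_1\sqsubseteq\mathcal{L}_2$ if for each formula in $\mathcal{L}_1$ there is a formula in $\mathcal{L}_2$ with the same semantics; $\mathcal{L}_1\sqsubsetneq\mathcal{L}_2$ if $\mathcal{L}_1\sqsubseteq\mathcal{L}_2$ but not $\mathcal{L}_2\sqsubseteq\mathcal{L}_1$. -}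

module Defs where

open import Level using (0ℓ; Lift; lift) renaming (suc to lsuc)
open import Data.Empty using (⊥)
open import Data.Unit.Base using (⊤)
open import Data.List.Base using (List; []; _∷_; _++_)
open import Data.List.Membership.Propositional using (_∈_; _∉_)
open import Data.List.Relation.Binary.Pointwise.Base using (Pointwise)
open import Data.List.Relation.Unary.AllPairs.Core using (AllPairs)
open import Data.Maybe.Base using (Maybe; just; nothing)
open import Data.Nat.Base using (ℕ; suc)
open import Data.Nat.Properties using (_≟_)
open import Data.Product.Base using (∃-syntax; _×_; _,_; proj₁; proj₂; map; map₂)
open import Data.Sum.Base as Sum using (_⊎_)
open import Function.Base using (_∘_)
open import Relation.Binary.Construct.Closure.ReflexiveTransitive using (Star)
open import Relation.Binary.PropositionalEquality.Core using (_≡_)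
open import Relation.Nullary.Decidable.Core using (yes; no)
open import Relation.Nullary.Negation.Core using (¬_)
open import Relation.Unary using (Pred; _⊆_; _≐_)

------------------------------------------------------------------------
-- Syntax

DVar FVar : Set
DVar = ℕ
FVar = ℕ

infix  8 `_
infix  7 _==_
infixr 6 _&_
infix  7 ~_
infixr 5 _∧_
infixr 4 _∨_
infixr 6 ⟨_⟩_ [_]_
infixr 3 ∃′_∙_ ∀′_∙_ min_∙_ max_∙_

data DTerm : Set where
  `_ : DVar → DTerm
  ⋆  : DTerm

data Constraint : Set where
  true : Constraint
  _==_ : DTerm → DTerm → Constraint
  ~_   : Constraint → Constraint
  _&_  : Constraint → Constraint → Constraint

data Formula : Set where
  tt ff           : Formula
  ⟨_⟩_ [_]_       : Constraint → Formula → Formula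
  ∃′_∙_ ∀′_∙_     : DVar → Formula → Formula
  _∨_ _∧_         : Formula → Formula → Formula
  min_∙_ max_∙_   : FVar → Formula → Formula
  var             : FVar → Formula

Class : Set₁
Class = Pred Formula 0ℓ

------------------------------------------------------------------------
-- Closed formulae

-- Δ and Γ list the data and recursion variables in scope.

TermIn : List DVar → DTerm → Set
TermIn Δ (` x) = x ∈ Δ
TermIn Δ ⋆     = ⊤

ConstraintIn : List DVar → Constraint → Set
ConstraintIn Δ true     = ⊤
ConstraintIn Δ (e == f) = TermIn Δ e × TermIn Δ f
ConstraintIn Δ (~ b)    = ConstraintIn Δ b
ConstraintIn Δ (b & c)  = ConstraintIn Δ b × ConstraintIn Δ c

FormulaIn : List DVar → List FVar → Formula → Set
FormulaIn Δ Γ tt          = ⊤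
FormulaIn Δ Γ ff          = ⊤
FormulaIn Δ Γ (⟨ b ⟩ φ)   = ConstraintIn Δ b × FormulaIn Δ Γ φ
FormulaIn Δ Γ ([ b ] φ)   = ConstraintIn Δ b × FormulaIn Δ Γ φ
FormulaIn Δ Γ (∃′ x ∙ φ)  = FormulaIn (x ∷ Δ) Γ φ
FormulaIn Δ Γ (∀′ x ∙ φ)  = FormulaIn (x ∷ Δ) Γ φ
FormulaIn Δ Γ (φ ∨ ψ)     = FormulaIn Δ Γ φ × FormulaIn Δ Γ ψ
FormulaIn Δ Γ (φ ∧ ψ)     = FormulaIn Δ Γ φ × FormulaIn Δ Γ ψ
FormulaIn Δ Γ (min X ∙ φ) = FormulaIn Δ (X ∷ Γ) φ
FormulaIn Δ Γ (max X ∙ φ) = FormulaIn Δ (X ∷ Γ) φ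
FormulaIn Δ Γ (var X)     = X ∈ Γ

Closed : Class
Closed = FormulaIn [] []

------------------------------------------------------------------------
-- Guardedness

-- U lists the recursion variables bound since the last modality.

GuardedBelow : List FVar → Formula → Set
GuardedBelow U tt          = ⊤
GuardedBelow U ff          = ⊤
GuardedBelow U (⟨ b ⟩ φ)   = GuardedBelow [] φ
GuardedBelow U ([ b ] φ)   = GuardedBelow [] φ
GuardedBelow U (∃′ x ∙ φ)  = GuardedBelow U φ
GuardedBelow U (∀′ x ∙ φ)  = GuardedBelow U φ
GuardedBelow U (φ ∨ ψ)     = GuardedBelow U φ × GuardedBelow U ψ
GuardedBelow U (φ ∧ ψ)     = GuardedBelow U φ × GuardedBelow U ψ
GuardedBelow U (min X ∙ φ) = GuardedBelow (X ∷ U) φ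
GuardedBelow U (max X ∙ φ) = GuardedBelow (X ∷ U) φ
GuardedBelow U (var X)     = X ∉ U

Guarded : Class
Guarded = GuardedBelow []

------------------------------------------------------------------------
-- Fragments by constructs

μHML : Class
μHML φ = Closed φ × Guarded φ

data Construct : Set where
  minᶜ maxᶜ ∃ᶜ ∀ᶜ ⟨⟩ᶜ []ᶜ ∨ᶜ ∧ᶜ : Construct

-- ff is available exactly when all the constructs are, and recursion
-- variables exactly when some fixed-point operator is.

BuiltFrom : List Construct → Class
BuiltFrom C tt          = ⊤
BuiltFrom C ff          = ∀ c → c ∈ C
BuiltFrom C (⟨ b ⟩ φ)   = ⟨⟩ᶜ ∈ C × BuiltFrom C φ
BuiltFrom C ([ b ] φ)   = []ᶜ ∈ C × BuiltFrom C φ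
BuiltFrom C (∃′ x ∙ φ)  = ∃ᶜ ∈ C × BuiltFrom C φ
BuiltFrom C (∀′ x ∙ φ)  = ∀ᶜ ∈ C × BuiltFrom C φ
BuiltFrom C (φ ∨ ψ)     = ∨ᶜ ∈ C × BuiltFrom C φ × BuiltFrom C ψ
BuiltFrom C (φ ∧ ψ)     = ∧ᶜ ∈ C × BuiltFrom C φ × BuiltFrom C ψ
BuiltFrom C (min X ∙ φ) = minᶜ ∈ C × BuiltFrom C φ
BuiltFrom C (max X ∙ φ) = maxᶜ ∈ C × BuiltFrom C φ
BuiltFrom C (var X)     = minᶜ ∈ C ⊎ maxᶜ ∈ C

HML : List Construct → Class
HML C φ = μHML φ × BuiltFrom C φ

------------------------------------------------------------------------
-- Subformulae

infix 2 _◁_ _◁*_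

data _◁_ : Formula → Formula → Set where
  ⟨⟩◁  : ∀ {b φ}   → φ ◁ ⟨ b ⟩ φ
  []◁  : ∀ {b φ}   → φ ◁ [ b ] φ
  ∃◁   : ∀ {x φ}   → φ ◁ ∃′ x ∙ φ
  ∀◁   : ∀ {x φ}   → φ ◁ ∀′ x ∙ φ
  ∨◁ˡ  : ∀ {φ ψ}   → φ ◁ φ ∨ ψ
  ∨◁ʳ  : ∀ {φ ψ}   → ψ ◁ φ ∨ ψ
  ∧◁ˡ  : ∀ {φ ψ}   → φ ◁ φ ∧ ψ
  ∧◁ʳ  : ∀ {φ ψ}   → ψ ◁ φ ∧ ψ
  min◁ : ∀ {X φ}   → φ ◁ min X ∙ φ
  max◁ : ∀ {X φ}   → φ ◁ max X ∙ φ

_◁*_ : Formula → Formula → Set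
_◁*_ = Star _◁_

------------------------------------------------------------------------
-- The restriction "match"

-- Equations are unoriented: "det" writes ⋆ = x where "match" writes x = ⋆,
-- although it includes "match".

data IsCurrent (x : DVar) : Constraint → Set where
  x=⋆ : IsCurrent x (` x == ⋆)
  ⋆=x : IsCurrent x (⋆ == ` x)

data MatchBody (x : DVar) : Formula → Set where
  matchBody : ∀ {c b φ} → IsCurrent x c → MatchBody x (⟨ c & b ⟩ φ)

Match : Class
Match χ = ∀ {x φ} → ∃′ x ∙ φ ◁* χ → MatchBody x φ

------------------------------------------------------------------------
-- Semantics over a set 𝔻 of data values

module Semantics (𝔻 : Set) where

  Trc : Set
  Trc = ℕ → 𝔻

  head : Trc → 𝔻
  head t = t 0

  tail : Trc → Trc
  tail t = t ∘ suc

  -- A finite partial function is given by a list of bindings, the leftmost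
  -- binding of a variable taking precedence.  Several lists may present the
  -- same partial function; formulae see an environment through lookup only.

  DEnv : Set
  DEnv = List (DVar × 𝔻)

  lookup : DEnv → DVar → Maybe 𝔻
  lookup []            x = nothing
  lookup ((y , d) ∷ δ) x with x ≟ y
  ... | yes _ = just d
  ... | no  _ = lookup δ x

  _[_↦_] : DEnv → DVar → 𝔻 → DEnv
  δ [ x ↦ d ] = (x , d) ∷ δ

  Valuation : Set
  Valuation = DTerm → Maybe 𝔻

  _[⋆↦_] : DEnv → 𝔻 → Valuation
  (δ [⋆↦ d ]) (` x) = lookup δ x
  (δ [⋆↦ d ]) ⋆     = just d

  -- An equation involving an undefined variable is taken to be false; this
  -- case is never reached from a closed formula in the empty environment.

  Holds : Valuation → Constraint → Set
  Holds v true     = ⊤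
  Holds v (e == f) = ∃[ d ] v e ≡ just d × v f ≡ just d
  Holds v (~ b)    = ¬ Holds v b
  Holds v (b & c)  = Holds v b × Holds v c

  -- Satisfiability ranges over total valuations, so it does not depend on
  -- the treatment of undefined variables.

  Unsatisfiable : Constraint → Set
  Unsatisfiable b = ∀ (v : DTerm → 𝔻) → ¬ Holds (just ∘ v) b

  ----------------------------------------------------------------------
  -- The restriction "det"

  -- The disjuncts of an iterated binary disjunction, however bracketed.

  disjuncts : Formula → List Formula
  disjuncts (φ ∨ ψ) = disjuncts φ ++ disjuncts ψ
  disjuncts φ       = φ ∷ []

  data DetBranch (x : DVar) (b : Constraint) : Formula → Set where
    detBranch : ∀ {c φ} → IsCurrent x c → DetBranch x b (∃′ x ∙ ⟨ c & b ⟩ φ)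

  DetDisjunction : Formula → Set
  DetDisjunction χ = ∃[ x ] ∃[ bs ]
    Pointwise (DetBranch x) bs (disjuncts χ) ×
    AllPairs (λ b c → Unsatisfiable (b & c)) bs

  Det : Class
  Det χ = Match χ × (∀ {φ ψ} → φ ∨ ψ ◁* χ → DetDisjunction (φ ∨ ψ))

  ----------------------------------------------------------------------
  -- Data interpretations and fixed points

  Interp : Set₁
  Interp = DEnv → Pred Trc 0ℓ

  infix 4 _⊑ᵢ_ _≈ᵢ_

  _⊑ᵢ_ _≈ᵢ_ : Interp → Interp → Set
  F ⊑ᵢ G = ∀ δ → F δ ⊆ G δ
  F ≈ᵢ G = ∀ δ → F δ ≐ G δ

  LeastFixedPoint GreatestFixedPoint : (Interp → Interp) → Interp → Set₁
  LeastFixedPoint    Φ F = Φ F ≈ᵢ F × (∀ G → Φ G ≈ᵢ G → F ⊑ᵢ G)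
  GreatestFixedPoint Φ F = Φ F ≈ᵢ F × (∀ G → Φ G ≈ᵢ G → G ⊑ᵢ F)

  TEnv : Set₁
  TEnv = FVar → Interp

  _[_↦ᵢ_] : TEnv → FVar → Interp → TEnv
  (ρ [ X ↦ᵢ F ]) Y with Y ≟ X
  ... | yes _ = F
  ... | no  _ = ρ Y

  -- ⟦ φ ⟧ ρ F says that F is the interpretation λ δ → ⟦ φ , ρ , δ ⟧, up to
  -- extensional equality of sets.  The semantics is a relation because
  -- predicatively a monotone operator on Interp cannot be shown in general
  -- to have a least or a greatest fixed point in Interp.

  ⟦_⟧ : Formula → TEnv → Interp → Set₁

  Operator : FVar → Formula → TEnv → (Interp → Interp) → Set₁
  Operator X φ ρ Φ = ∀ G → ⟦ φ ⟧ (ρ [ X ↦ᵢ G ]) (Φ G)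

  ⟦ tt ⟧ ρ F        = Lift (lsuc 0ℓ) (F ≈ᵢ (λ δ t → ⊤))
  ⟦ ff ⟧ ρ F        = Lift (lsuc 0ℓ) (F ≈ᵢ (λ δ t → ⊥))
  ⟦ ⟨ b ⟩ φ ⟧ ρ F   = ∃[ G ] ⟦ φ ⟧ ρ G ×
                      F ≈ᵢ λ δ t → Holds (δ [⋆↦ head t ]) b × G δ (tail t)
  ⟦ [ b ] φ ⟧ ρ F   = ∃[ G ] ⟦ φ ⟧ ρ G ×
                      F ≈ᵢ λ δ t → Holds (δ [⋆↦ head t ]) b → G δ (tail t)
  ⟦ ∃′ x ∙ φ ⟧ ρ F  = ∃[ G ] ⟦ φ ⟧ ρ G × F ≈ᵢ λ δ t → ∃[ d ] G (δ [ x ↦ d ]) t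
  ⟦ ∀′ x ∙ φ ⟧ ρ F  = ∃[ G ] ⟦ φ ⟧ ρ G × F ≈ᵢ λ δ t → ∀ d → G (δ [ x ↦ d ]) t
  ⟦ φ ∨ ψ ⟧ ρ F     = ∃[ G ] ∃[ H ] ⟦ φ ⟧ ρ G × ⟦ ψ ⟧ ρ H ×
                      F ≈ᵢ λ δ t → G δ t ⊎ H δ t
  ⟦ φ ∧ ψ ⟧ ρ F     = ∃[ G ] ∃[ H ] ⟦ φ ⟧ ρ G × ⟦ ψ ⟧ ρ H ×
                      F ≈ᵢ λ δ t → G δ t × H δ t
  ⟦ min X ∙ φ ⟧ ρ F = ∃[ Φ ] Operator X φ ρ Φ × LeastFixedPoint Φ F
  ⟦ max X ∙ φ ⟧ ρ F = ∃[ Φ ] Operator X φ ρ Φ × GreatestFixedPoint Φ F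
  ⟦ var X ⟧ ρ F     = Lift (lsuc 0ℓ) (F ≈ᵢ ρ X)

  private
    ≈ᵢ-sym : ∀ {F G} → F ≈ᵢ G → G ≈ᵢ F
    ≈ᵢ-sym p δ = let (f , g) = p δ in g , f

    ≈ᵢ-trans : ∀ {F G H} → F ≈ᵢ G → G ≈ᵢ H → F ≈ᵢ H
    ≈ᵢ-trans p q δ = let (f , f⁻) = p δ ; (g , g⁻) = q δ in
      (λ z → g (f z)) , (λ z → f⁻ (g⁻ z))

    infix 5 _⨾_⨾_
    _⨾_⨾_ : ∀ {F F′ G G′} → F ≈ᵢ G → G ≈ᵢ G′ → F′ ≈ᵢ G′ → F ≈ᵢ F′
    p ⨾ q ⨾ r = ≈ᵢ-trans p (≈ᵢ-trans q (≈ᵢ-sym r))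

    update-cong : ∀ {ρ ρ′ : TEnv} X G → (∀ Y → ρ Y ≈ᵢ ρ′ Y) →
                  ∀ Y → (ρ [ X ↦ᵢ G ]) Y ≈ᵢ (ρ′ [ X ↦ᵢ G ]) Y
    update-cong X G ρ≈ Y with Y ≟ X
    ... | yes _ = λ δ → (λ z → z) , (λ z → z)
    ... | no  _ = ρ≈ Y

  ⟦⟧-functional : ∀ φ {ρ ρ′ F F′} → (∀ X → ρ X ≈ᵢ ρ′ X) →
                  ⟦ φ ⟧ ρ F → ⟦ φ ⟧ ρ′ F′ → F ≈ᵢ F′
  ⟦⟧-functional tt ρ≈ (lift p) (lift q) = ≈ᵢ-trans p (≈ᵢ-sym q)
  ⟦⟧-functional ff ρ≈ (lift p) (lift q) = ≈ᵢ-trans p (≈ᵢ-sym q)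
  ⟦⟧-functional (⟨ b ⟩ φ) ρ≈ (_ , g , p) (_ , g′ , q) =
    let e = ⟦⟧-functional φ ρ≈ g g′ in
    p ⨾ (λ δ → map₂ (proj₁ (e δ)) , map₂ (proj₂ (e δ))) ⨾ q
  ⟦⟧-functional ([ b ] φ) ρ≈ (_ , g , p) (_ , g′ , q) =
    let e = ⟦⟧-functional φ ρ≈ g g′ in
    p ⨾ (λ δ → (λ f h → proj₁ (e δ) (f h)) , (λ f h → proj₂ (e δ) (f h))) ⨾ q
  ⟦⟧-functional (∃′ x ∙ φ) ρ≈ (_ , g , p) (_ , g′ , q) =
    let e = ⟦⟧-functional φ ρ≈ g g′ in
    p ⨾ (λ δ → map₂ (proj₁ (e _)) , map₂ (proj₂ (e _))) ⨾ q
  ⟦⟧-functional (∀′ x ∙ φ) ρ≈ (_ , g , p) (_ , g′ , q) =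
    let e = ⟦⟧-functional φ ρ≈ g g′ in
    p ⨾ (λ δ → (λ f d → proj₁ (e _) (f d)) , (λ f d → proj₂ (e _) (f d))) ⨾ q
  ⟦⟧-functional (φ ∨ ψ) ρ≈ (_ , _ , g , h , p) (_ , _ , g′ , h′ , q) =
    let e = ⟦⟧-functional φ ρ≈ g g′ ; e′ = ⟦⟧-functional ψ ρ≈ h h′ in
    p ⨾ (λ δ → Sum.map (proj₁ (e δ)) (proj₁ (e′ δ)) ,
               Sum.map (proj₂ (e δ)) (proj₂ (e′ δ))) ⨾ q
  ⟦⟧-functional (φ ∧ ψ) ρ≈ (_ , _ , g , h , p) (_ , _ , g′ , h′ , q) =
    let e = ⟦⟧-functional φ ρ≈ g g′ ; e′ = ⟦⟧-functional ψ ρ≈ h h′ in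
    p ⨾ (λ δ → map (proj₁ (e δ)) (proj₁ (e′ δ)) ,
               map (proj₂ (e δ)) (proj₂ (e′ δ))) ⨾ q
  ⟦⟧-functional (min X ∙ φ) {F = F} {F′} ρ≈ (Φ , op , fix , least) (Φ′ , op′ , fix′ , least′) =
    let e : ∀ G → Φ G ≈ᵢ Φ′ G
        e G = ⟦⟧-functional φ (update-cong X G ρ≈) (op G) (op′ G)
    in λ δ → least F′ (≈ᵢ-trans (e F′) fix′) δ ,
             least′ F (≈ᵢ-trans (≈ᵢ-sym (e F)) fix) δ
  ⟦⟧-functional (max X ∙ φ) {F = F} {F′} ρ≈ (Φ , op , fix , greatest) (Φ′ , op′ , fix′ , greatest′) =
    let e : ∀ G → Φ G ≈ᵢ Φ′ G
        e G = ⟦⟧-functional φ (update-cong X G ρ≈) (op G) (op′ G)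
    in λ δ → greatest′ F (≈ᵢ-trans (≈ᵢ-sym (e F)) fix) δ ,
             greatest F′ (≈ᵢ-trans (e F′) fix′) δ
  ⟦⟧-functional (var X) ρ≈ (lift p) (lift q) = p ⨾ ρ≈ X ⨾ q

  ----------------------------------------------------------------------
  -- Expressiveness

  -- The interpretation of a closed formula does not depend on the choice of
  -- trace environment.

  ∅ : TEnv
  ∅ X δ t = ⊥

  ⟦_⟧₀ : Formula → Pred Trc 0ℓ → Set₁
  ⟦ φ ⟧₀ S = ∃[ F ] ⟦ φ ⟧ ∅ F × F [] ≐ S

  infix 4 _≋_ _⊑_ _⊏_

  _≋_ : Formula → Formula → Set₁
  φ ≋ ψ = ∃[ S ] ⟦ φ ⟧₀ S × ⟦ ψ ⟧₀ S

  _⊑_ _⊏_ : Class → Class → Set₁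
  L₁ ⊑ L₂ = ∀ φ → L₁ φ → ∃[ ψ ] L₂ ψ × φ ≋ ψ
  L₁ ⊏ L₂ = L₁ ⊑ L₂ × ¬ (L₂ ⊑ L₁)

-- The inclusions are of classes of formulae, so they only need a semantics,
-- which exists because without max, ∀ and [ ] the operators are ω-continuous.
--
-- Strictness is witnessed, in order, by the following languages.
--   recurs:    the first datum occurs again;
--   repeats:   some datum other than the first occurs twice;
--   turns:     some datum other than the first is, where it first occurs,
--              followed by the first datum;
--   injects:   the first datum occurs again and the data up to there are distinct;
--   exhausts:  every datum occurs.
-- A formula without fixed points has finite depth, and one built with min but
-- without max, ∀ and [ ] defines an open set; this settles the first and the
-- last step.  The others compare the traces 0 1 … N 0 0 0 … with their
-- modifications that carry an earlier i in place of a later j.  Without ∧, a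
-- formula of quantifier rank K knows at each moment only K data, so some i
-- among 1 … K + 1 is unknown to it, and it confuses i with an unknown j.  With
-- match the known data come from the past, so j may be any new datum, and with
-- det they depend only on the past, so i may be chosen after the prefix is read.

module Submission where

open import Defs
open import Level using (0ℓ; lift)
open import Data.Empty using (⊥; ⊥-elim)
open import Data.Unit.Base using (⊤)
open import Data.Fin.Base using (toℕ)
open import Data.Fin.Properties using (¬∀⟶∃¬; pigeonhole; toℕ≤pred[n])
open import Data.List.Base as List using (List; []; _∷_; _++_; length)
import Data.List.Membership.DecPropositional as DecMembership
open import Data.List.Membership.Propositional using (_∈_; _∉_; mapWith∈)
open import Data.List.Membership.Propositional.Properties using (∈-++⁺ˡ; ∈-++⁺ʳ)
open import Data.List.Membership.Setoid.Properties using (length-mapWith∈)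
open import Data.List.Relation.Binary.Pointwise.Base using (Pointwise; []; _∷_)
open import Data.List.Relation.Unary.All as All using (All; []; _∷_)
open import Data.List.Relation.Unary.AllPairs.Core using (AllPairs; []; _∷_)
open import Data.List.Relation.Unary.Any using (here; there; index)
open import Data.List.Relation.Unary.Any.Properties using (lookup-index; mapWith∈⁺; mapWith∈⁻)
open import Data.Maybe.Base as Maybe using (Maybe; just)
open import Data.Maybe.Properties using (just-injective)
open import Data.Nat.Base using (ℕ; zero; suc; _+_; _⊔_; _≤_; _<_; z≤n; s≤s; z<s; s<s; s<s⁻¹)
open import Relation.Binary.Definitions using (DecidableEquality; tri<; tri≈; tri>)
open import Data.Nat.Properties
open import Data.Product.Base using (∃-syntax; _×_; _,_; proj₁; proj₂)
open import Data.Sum.Base as Sum using (_⊎_; inj₁; inj₂)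
open import Function.Base using (id; _∘_)
open import Function.Bundles using (_↔_; module Injection; module Inverse)
open import Function.Properties.Inverse using (↔-sym; ↔⇒↣)
open import Function.Definitions using (Injective)
open import Relation.Binary.Construct.Closure.ReflexiveTransitive using (ε; _◅_; _◅◅_)
open import Relation.Binary.PropositionalEquality
  using (_≡_; _≢_; refl; sym; trans; cong; subst; setoid; module ≡-Reasoning)
open import Relation.Nullary.Decidable using (via-injection)
open import Relation.Nullary using (yes; no; ¬_; contradiction)
open import Relation.Unary using (Pred; _∩_; _≐_; U)

pattern #0 = here refl
pattern #1 = there #0
pattern #2 = there #1
pattern #3 = there #2
pattern #4 = there #3
pattern #5 = there #4
pattern #6 = there #5
pattern #7 = there #6

-- Construct sets and the fragments they generate.

built-from-all : ∀ {C} → (∀ c → c ∈ C) → ∀ φ → BuiltFrom C φ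
built-from-all c tt          = _
built-from-all c ff          = c
built-from-all c (⟨ b ⟩ φ)   = c ⟨⟩ᶜ , built-from-all c φ
built-from-all c ([ b ] φ)   = c []ᶜ , built-from-all c φ
built-from-all c (∃′ x ∙ φ)  = c ∃ᶜ , built-from-all c φ
built-from-all c (∀′ x ∙ φ)  = c ∀ᶜ , built-from-all c φ
built-from-all c (φ ∨ ψ)     = c ∨ᶜ , built-from-all c φ , built-from-all c ψ
built-from-all c (φ ∧ ψ)     = c ∧ᶜ , built-from-all c φ , built-from-all c ψ
built-from-all c (min X ∙ φ) = c minᶜ , built-from-all c φ
built-from-all c (max X ∙ φ) = c maxᶜ , built-from-all c φ
built-from-all c (var X)     = inj₁ (c minᶜ)

all-constructs : ∀ c → c ∈ minᶜ ∷ maxᶜ ∷ ∃ᶜ ∷ ∀ᶜ ∷ ⟨⟩ᶜ ∷ []ᶜ ∷ ∨ᶜ ∷ ∧ᶜ ∷ []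
all-constructs minᶜ = #0
all-constructs maxᶜ = #1
all-constructs ∃ᶜ   = #2
all-constructs ∀ᶜ   = #3
all-constructs ⟨⟩ᶜ  = #4
all-constructs []ᶜ  = #5
all-constructs ∨ᶜ   = #6
all-constructs ∧ᶜ   = #7

built-from-mono : ∀ {C C′} → (∀ {c} → c ∈ C → c ∈ C′) → ∀ φ → BuiltFrom C φ → BuiltFrom C′ φ
built-from-mono C⊆ tt          p           = p
built-from-mono C⊆ ff          p           = λ c → C⊆ (p c)
built-from-mono C⊆ (⟨ b ⟩ φ)   (c , p)     = C⊆ c , built-from-mono C⊆ φ p
built-from-mono C⊆ ([ b ] φ)   (c , p)     = C⊆ c , built-from-mono C⊆ φ p
built-from-mono C⊆ (∃′ x ∙ φ)  (c , p)     = C⊆ c , built-from-mono C⊆ φ p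
built-from-mono C⊆ (∀′ x ∙ φ)  (c , p)     = C⊆ c , built-from-mono C⊆ φ p
built-from-mono C⊆ (φ ∨ ψ)     (c , p , q) = C⊆ c , built-from-mono C⊆ φ p , built-from-mono C⊆ ψ q
built-from-mono C⊆ (φ ∧ ψ)     (c , p , q) = C⊆ c , built-from-mono C⊆ φ p , built-from-mono C⊆ ψ q
built-from-mono C⊆ (min X ∙ φ) (c , p)     = C⊆ c , built-from-mono C⊆ φ p
built-from-mono C⊆ (max X ∙ φ) (c , p)     = C⊆ c , built-from-mono C⊆ φ p
built-from-mono C⊆ (var X)     p           = Sum.map C⊆ C⊆ p

-- Positive formulae evaluated by finite approximation.

module Evaluation (𝔻 : Set) where

  open Semantics 𝔻

  infix 4 _⊆ᵉ_

  _⊆ᵉ_ : TEnv → TEnv → Set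
  ρ ⊆ᵉ ρ′ = ∀ X → ρ X ⊑ᵢ ρ′ X

  -- A single case split serves every relation carried through an update; a predicate on
  -- interpretations is passed as a relation that ignores its second argument.
  update : ∀ {a} (R : Interp → Interp → Set a) {ρ ρ′ : TEnv} X {F G} →
           R F G → (∀ Y → R (ρ Y) (ρ′ Y)) →
           ∀ Y → R ((ρ [ X ↦ᵢ F ]) Y) ((ρ′ [ X ↦ᵢ G ]) Y)
  update R X r rs Y with Y ≟ X
  ... | yes _ = r
  ... | no  _ = rs Y

  -- A least fixed point is computed as the union of its finite approximations,
  -- which is right because the operators below preserve unions of chains.
  -- This fails for max and ∀; the constructs outside Positive get the junk
  -- value ⊥.

  eval   : Formula → TEnv → Interp
  approx : FVar → Formula → TEnv → ℕ → Interp

  eval tt          ρ δ t = ⊤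
  eval (⟨ b ⟩ φ)   ρ δ t = Holds (δ [⋆↦ head t ]) b × eval φ ρ δ (tail t)
  eval (∃′ x ∙ φ)  ρ δ t = ∃[ d ] eval φ ρ (δ [ x ↦ d ]) t
  eval (φ ∨ ψ)     ρ δ t = eval φ ρ δ t ⊎ eval ψ ρ δ t
  eval (φ ∧ ψ)     ρ δ t = eval φ ρ δ t × eval ψ ρ δ t
  eval (min X ∙ φ) ρ δ t = ∃[ n ] approx X φ ρ n δ t
  eval (var X)     ρ δ t = ρ X δ t
  eval ff          ρ δ t = ⊥
  eval ([ b ] φ)   ρ δ t = ⊥
  eval (∀′ x ∙ φ)  ρ δ t = ⊥
  eval (max X ∙ φ) ρ δ t = ⊥

  approx X φ ρ zero    δ t = ⊥
  approx X φ ρ (suc n) δ t = eval φ (ρ [ X ↦ᵢ approx X φ ρ n ]) δ t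

  mono        : ∀ φ {ρ ρ′} → ρ ⊆ᵉ ρ′ → eval φ ρ ⊑ᵢ eval φ ρ′
  approx-mono : ∀ X φ {ρ ρ′} → ρ ⊆ᵉ ρ′ → ∀ n → approx X φ ρ n ⊑ᵢ approx X φ ρ′ n

  mono tt          ρ⊆ δ p       = p
  mono (⟨ b ⟩ φ)   ρ⊆ δ (h , p) = h , mono φ ρ⊆ δ p
  mono (∃′ x ∙ φ)  ρ⊆ δ (d , p) = d , mono φ ρ⊆ _ p
  mono (φ ∨ ψ)     ρ⊆ δ         = Sum.map (mono φ ρ⊆ δ) (mono ψ ρ⊆ δ)
  mono (φ ∧ ψ)     ρ⊆ δ (p , q) = mono φ ρ⊆ δ p , mono ψ ρ⊆ δ q
  mono (min X ∙ φ) ρ⊆ δ (n , p) = n , approx-mono X φ ρ⊆ n δ p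
  mono (var X)     ρ⊆ δ p       = ρ⊆ X δ p

  approx-mono X φ ρ⊆ (suc n) =
    mono φ (update _⊑ᵢ_ X (approx-mono X φ ρ⊆ n) ρ⊆)

  Chain : (ℕ → TEnv) → Set
  Chain ρs = ∀ {m n} → m ≤ n → ρs m ⊆ᵉ ρs n

  infix 4 _⊆⋃_
  _⊆⋃_ : TEnv → (ℕ → TEnv) → Set
  ρ ⊆⋃ ρs = ∀ X δ {t} → ρ X δ t → ∃[ n ] ρs n X δ t

  -- Membership consults the environment finitely often, so some stage of the chain suffices; at a
  -- conjunction `Chain` moves both halves to the later of two stages.
  cont        : ∀ φ {ρ ρs} → Chain ρs → ρ ⊆⋃ ρs →
                ∀ δ {t} → eval φ ρ δ t → ∃[ n ] eval φ (ρs n) δ t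
  approx-cont : ∀ X φ {ρ ρs} → Chain ρs → ρ ⊆⋃ ρs →
                ∀ k δ {t} → approx X φ ρ k δ t → ∃[ n ] approx X φ (ρs n) k δ t

  cont tt          c ρ⊆ δ p        = 0 , p
  cont (⟨ b ⟩ φ)   c ρ⊆ δ (h , p)  = let n , q = cont φ c ρ⊆ δ p in n , h , q
  cont (∃′ x ∙ φ)  c ρ⊆ δ (d , p)  = let n , q = cont φ c ρ⊆ _ p in n , d , q
  cont (φ ∨ ψ)     c ρ⊆ δ (inj₁ p) = let n , q = cont φ c ρ⊆ δ p in n , inj₁ q
  cont (φ ∨ ψ)     c ρ⊆ δ (inj₂ p) = let n , q = cont ψ c ρ⊆ δ p in n , inj₂ q
  cont (φ ∧ ψ)     c ρ⊆ δ (p , q)  =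
    let m , p′ = cont φ c ρ⊆ δ p ; n , q′ = cont ψ c ρ⊆ δ q in
    m ⊔ n , mono φ (c (m≤m⊔n m n)) δ p′ , mono ψ (c (m≤n⊔m m n)) δ q′
  cont (min X ∙ φ) c ρ⊆ δ (k , p)  =
    let n , q = approx-cont X φ c ρ⊆ k δ p in n , k , q
  cont (var X)     c ρ⊆ δ p        = ρ⊆ X δ p

  approx-cont X φ {ρ} {ρs} c ρ⊆ (suc k) = cont φ
    (λ m≤n → update _⊑ᵢ_ X (approx-mono X φ (c m≤n) k) (c m≤n)) ρ⊆′
    where
    ρ⊆′ : ρ [ X ↦ᵢ approx X φ ρ k ] ⊆⋃ λ n → ρs n [ X ↦ᵢ approx X φ (ρs n) k ]
    ρ⊆′ Y with Y ≟ X
    ... | yes _ = approx-cont X φ c ρ⊆ k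
    ... | no  _ = ρ⊆ Y

  approx-chain : ∀ X φ ρ {m n} → m ≤ n → approx X φ ρ m ⊑ᵢ approx X φ ρ n
  approx-chain X φ ρ (s≤s m≤n) =
    mono φ (update _⊑ᵢ_ X (approx-chain X φ ρ m≤n) (λ _ _ p → p))

  unfold : ∀ X φ ρ →
           eval (min X ∙ φ) ρ ⊑ᵢ eval φ (ρ [ X ↦ᵢ eval (min X ∙ φ) ρ ])
  unfold X φ ρ δ (suc n , p) =
    mono φ (update _⊑ᵢ_ X (λ _ q → n , q) (λ _ _ q → q)) δ p

  -- By continuity the body consults a single approximation `n` of the fixed point, which puts the
  -- trace into stage `suc n`.
  fold : ∀ X φ ρ →
         eval φ (ρ [ X ↦ᵢ eval (min X ∙ φ) ρ ]) ⊑ᵢ eval (min X ∙ φ) ρ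
  fold X φ ρ δ p = let n , q = cont φ chain ρ⊆ δ p in suc n , q
    where
    chain : Chain (λ n → ρ [ X ↦ᵢ approx X φ ρ n ])
    chain m≤n = update _⊑ᵢ_ X (approx-chain X φ ρ m≤n) (λ _ _ q → q)
    ρ⊆ : ρ [ X ↦ᵢ eval (min X ∙ φ) ρ ] ⊆⋃ λ n → ρ [ X ↦ᵢ approx X φ ρ n ]
    ρ⊆ Y with Y ≟ X
    ... | yes _ = λ δ q → q
    ... | no  _ = λ δ q → 0 , q

  Positive : Class
  Positive = BuiltFrom (minᶜ ∷ ∃ᶜ ∷ ⟨⟩ᶜ ∷ ∨ᶜ ∷ ∧ᶜ ∷ [])

  -- At `min` this is Kleene's fixed point theorem: `fold` and `unfold` make the union of the stages
  -- a fixed point, and by induction each stage lies below any other fixed point.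
  eval-correct : ∀ φ {ρ} → Positive φ → ⟦ φ ⟧ ρ (eval φ ρ)
  eval-correct tt          p           = lift λ δ → id , id
  eval-correct (⟨ b ⟩ φ)   (_ , p)     = _ , eval-correct φ p , λ δ → id , id
  eval-correct (∃′ x ∙ φ)  (_ , p)     = _ , eval-correct φ p , λ δ → id , id
  eval-correct (φ ∨ ψ)     (_ , p , q) =
    _ , _ , eval-correct φ p , eval-correct ψ q , λ δ → id , id
  eval-correct (φ ∧ ψ)     (_ , p , q) =
    _ , _ , eval-correct φ p , eval-correct ψ q , λ δ → id , id
  eval-correct (min X ∙ φ) {ρ} (_ , p) =
    (λ G → eval φ (ρ [ X ↦ᵢ G ])) , (λ G → eval-correct φ p) ,
    (λ δ → fold X φ ρ δ , unfold X φ ρ δ) ,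
    λ G fix δ (n , q) → below fix n δ q
    where
    below : ∀ {G} → eval φ (ρ [ X ↦ᵢ G ]) ≈ᵢ G → ∀ n → approx X φ ρ n ⊑ᵢ G
    below fix (suc n) δ q =
      proj₁ (fix δ) (mono φ (update _⊑ᵢ_ X (below fix n) (λ _ _ r → r)) δ q)
  eval-correct (var X)     p           = lift λ δ → id , id
  -- `ff` demands every construct, and `maxᶜ` is missing from those of `Positive`.
  eval-correct ff          p with p maxᶜ
  ... | there (there (there (there (there ()))))
  eval-correct ([ b ] φ)   (there (there (there (there (there ())))) , _)
  eval-correct (∀′ x ∙ φ)  (there (there (there (there (there ())))) , _)
  eval-correct (max X ∙ φ) (there (there (there (there (there ())))) , _)

  lang : Formula → Pred Trc 0ℓ
  lang φ = eval φ ∅ []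

  -- As the semantics is functional, a formula equivalent to `φ` has the given interpretation of `φ`
  -- as its language, so refutations can compute with `lang ψ`. `F` is a parameter because `eval`
  -- gives no correct value for `exhausts`.
  express : ∀ {L L′ : Class} → (∀ ψ → L′ ψ → Positive ψ) → L ⊑ L′ →
            ∀ φ F → L φ → ⟦ φ ⟧ ∅ F → ∃[ ψ ] L′ ψ × F [] ≐ lang ψ
  express positive L⊑L′ φ F φ∈L ⟦φ⟧F =
    let ψ , ψ∈L′ , S , (G , ⟦φ⟧G , G≐S) , (H , ⟦ψ⟧H , H≐S) = L⊑L′ φ φ∈L
        F≐G = ⟦⟧-functional φ (λ X δ → id , id) ⟦φ⟧F ⟦φ⟧G []
        H≐E = ⟦⟧-functional ψ (λ X δ → id , id) ⟦ψ⟧H (eval-correct ψ (positive ψ ψ∈L′)) []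
    in ψ , ψ∈L′ , (λ p → proj₁ H≐E (proj₂ H≐S (proj₁ G≐S (proj₁ F≐G p)))) ,
                  (λ p → proj₂ F≐G (proj₂ G≐S (proj₁ H≐S (proj₂ H≐E p))))

  inclusion : ∀ {L L′ : Class} → (∀ φ → L φ → L′ φ × Positive φ) → L ⊑ L′
  inclusion L⊆ φ φ∈L = let φ∈L′ , p = L⊆ φ φ∈L in
    φ , φ∈L′ , lang φ , ⟦φ⟧ p , ⟦φ⟧ p
    where
    ⟦φ⟧ : Positive φ → ⟦ φ ⟧₀ (lang φ)
    ⟦φ⟧ p = _ , eval-correct φ p , id , id

  -- Dependence on finite prefixes.

  Agree : ℕ → Trc → Trc → Set
  Agree m t t′ = ∀ {i} → i < m → t′ i ≡ t i

  weaken : ∀ {m n t t′} → m ≤ n → Agree n t t′ → Agree m t t′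
  weaken m≤n a i<m = a (<-≤-trans i<m m≤n)

  agree-tail : ∀ {m t t′} → Agree (suc m) t t′ → Agree m (tail t) (tail t′)
  agree-tail a i<m = a (s<s i<m)

  -- The bound is the modal depth, uniform in traces and environments.
  finite-depth : ∀ φ {ρ} → BuiltFrom (∃ᶜ ∷ ⟨⟩ᶜ ∷ ∨ᶜ ∷ []) φ →
    ∃[ n ] ∀ {δ t t′} → Agree n t t′ → eval φ ρ δ t → eval φ ρ δ t′
  finite-depth tt         p           = 0 , λ _ q → q
  finite-depth (⟨ b ⟩ φ)  (_ , p)     = let n , f = finite-depth φ p in
    suc n , λ {δ} a (h , q) →
      subst (λ d → Holds (δ [⋆↦ d ]) b) (sym (a z<s)) h , f (agree-tail a) q
  finite-depth (∃′ x ∙ φ) (_ , p)     = let n , f = finite-depth φ p in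
    n , λ a (d , q) → d , f a q
  finite-depth (φ ∨ ψ)    (_ , p , q) =
    let m , f = finite-depth φ p ; n , g = finite-depth ψ q in
    m ⊔ n , λ a → Sum.map (f (weaken (m≤m⊔n m n) a)) (g (weaken (m≤n⊔m m n) a))
  finite-depth (φ ∧ ψ)     (there (there (there ())) , _)
  finite-depth (min X ∙ φ) (there (there (there ())) , _)
  finite-depth (var X)     (inj₁ (there (there (there ()))))
  finite-depth (var X)     (inj₂ (there (there (there ()))))
  finite-depth ff          p with p maxᶜ
  ... | there (there (there ()))
  finite-depth ([ b ] φ)   (there (there (there ())) , _)
  finite-depth (∀′ x ∙ φ)  (there (there (there ())) , _)
  finite-depth (max X ∙ φ) (there (there (there ())) , _)

  -- Openness in the product topology on traces, at each environment; unlike in `finite-depth`, the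
  -- length of the deciding prefix depends on the trace.
  Open : Interp → Set
  Open F = ∀ {δ t} → F δ t → ∃[ n ] ∀ {t′} → Agree n t t′ → F δ t′

  open-eval   : ∀ φ {ρ} → (∀ X → Open (ρ X)) → Open (eval φ ρ)
  open-approx : ∀ X φ {ρ} → (∀ Y → Open (ρ Y)) → ∀ n → Open (approx X φ ρ n)

  open-eval tt          o p        = 0 , λ _ → p
  open-eval (⟨ b ⟩ φ)   o {δ} (h , p)  = let n , f = open-eval φ o p in
    suc n , λ a → subst (λ d → Holds (δ [⋆↦ d ]) b) (sym (a z<s)) h ,
                  f (agree-tail a)
  open-eval (∃′ x ∙ φ)  o (d , p)  = let n , f = open-eval φ o p in
    n , λ a → d , f a
  open-eval (φ ∨ ψ)     o (inj₁ p) = let n , f = open-eval φ o p in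
    n , λ a → inj₁ (f a)
  open-eval (φ ∨ ψ)     o (inj₂ p) = let n , f = open-eval ψ o p in
    n , λ a → inj₂ (f a)
  open-eval (φ ∧ ψ)     o (p , q)  =
    let m , f = open-eval φ o p ; n , g = open-eval ψ o q in
    m ⊔ n , λ a → f (weaken (m≤m⊔n m n) a) , g (weaken (m≤n⊔m m n) a)
  open-eval (min X ∙ φ) o (k , p)  = let n , f = open-approx X φ o k p in
    n , λ a → k , f a
  open-eval (var X)     o p        = o X p

  open-approx X φ o (suc n) =
    open-eval φ (update (λ F _ → Open F) {ρ′ = ∅} X {G = ∅ X} (open-approx X φ o n) o)

  -- Equivariance under injective renamings.

  -- Both directions are proved together because negation exchanges them; injectivity is what
  -- reflects equations.
  Holds-rename : ∀ {Δ v v′} {π : 𝔻 → 𝔻} → Injective _≡_ _≡_ π →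
    (∀ e → TermIn Δ e → v′ e ≡ Maybe.map π (v e)) → ∀ b → ConstraintIn Δ b →
    (Holds v b → Holds v′ b) × (Holds v′ b → Holds v b)
  Holds-rename inj v≈ true     _       = id , id
  Holds-rename {v = v} {v′} {π} inj v≈ (e == f) (i , j) = to , from
    where
    to : Holds v (e == f) → Holds v′ (e == f)
    to (d , p , q) = π d , trans (v≈ e i) (cong (Maybe.map π) p) ,
                           trans (v≈ f j) (cong (Maybe.map π) q)
    from : Holds v′ (e == f) → Holds v (e == f)
    from (d , p , q)
      with v e | v f | trans (sym (v≈ e i)) p | trans (sym (v≈ f j)) q
    ... | just d₁ | just d₂ | p′ | q′ = d₁ , refl ,
      cong just (inj (just-injective (trans q′ (sym p′))))
  Holds-rename inj v≈ (~ b)    i       =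
    let to , from = Holds-rename inj v≈ b i in (λ h → h ∘ from) , (λ h → h ∘ to)
  Holds-rename inj v≈ (b & c)  (i , j) =
    let to , from = Holds-rename inj v≈ b i ; to′ , from′ = Holds-rename inj v≈ c j in
    (λ (h , k) → to h , to′ k) , (λ (h , k) → from h , from′ k)

  Renames : (𝔻 → 𝔻) → List DVar → DEnv → DEnv → Set
  Renames π Δ δ δ′ = ∀ {x} → x ∈ Δ → lookup δ′ x ≡ Maybe.map π (lookup δ x)

  renames-∷ : ∀ {π Δ δ δ′} x d → Renames π Δ δ δ′ →
              Renames π (x ∷ Δ) (δ [ x ↦ d ]) (δ′ [ x ↦ π d ])
  renames-∷ x d r {y} y∈ with y ≟ x | y∈
  ... | yes _   | _         = refl
  ... | no y≢x  | here y≡x  = contradiction y≡x y≢x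
  ... | no _    | there y∈Δ = r y∈Δ

  -- The renamed trace is given pointwise, which avoids function extensionality, and environments
  -- are compared on `Δ` alone.
  Equivariant : List DVar → Interp → Set
  Equivariant Δ F = ∀ {π} → Injective _≡_ _≡_ π → ∀ {δ δ′} → Renames π Δ δ δ′ →
    ∀ {t t′ : Trc} → (∀ i → t′ i ≡ π (t i)) → F δ t → F δ′ t′

  equivariant-∷ : ∀ {Δ F} x → Equivariant Δ F → Equivariant (x ∷ Δ) F
  equivariant-∷ x e inj r = e inj (r ∘ there)

  -- An existential witness `d` is carried forward to `π d`, so injectivity suffices for this
  -- one-way implication; negation is confined to constraints.
  equivariant   : ∀ φ {Δ Γ ρ} → FormulaIn Δ Γ φ → (∀ X → Equivariant Δ (ρ X)) →
                  Equivariant Δ (eval φ ρ)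
  equivariant-approx : ∀ X φ {Δ Γ ρ} → FormulaIn Δ Γ φ → (∀ X → Equivariant Δ (ρ X)) →
                  ∀ n → Equivariant Δ (approx X φ ρ n)

  equivariant tt          i       e inj r t≈ p = p
  equivariant (⟨ b ⟩ φ) {Δ} (i , j) e {π} inj {δ} {δ′} r {t} {t′} t≈ (h , p) =
    proj₁ (Holds-rename inj v≈ b i) h , equivariant φ j e inj r (t≈ ∘ suc) p
    where
    v≈ : ∀ f → TermIn Δ f → (δ′ [⋆↦ head t′ ]) f ≡ Maybe.map π ((δ [⋆↦ head t ]) f)
    v≈ (` x) x∈Δ = r x∈Δ
    v≈ ⋆     _   = cong just (t≈ 0)
  equivariant (∃′ x ∙ φ)  i       e {π} inj r t≈ (d , p) =
    π d , equivariant φ i (equivariant-∷ x ∘ e) inj (renames-∷ x d r) t≈ p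
  equivariant (φ ∨ ψ)     (i , j) e inj r t≈ =
    Sum.map (equivariant φ i e inj r t≈) (equivariant ψ j e inj r t≈)
  equivariant (φ ∧ ψ)     (i , j) e inj r t≈ (p , q) =
    equivariant φ i e inj r t≈ p , equivariant ψ j e inj r t≈ q
  equivariant (min X ∙ φ) i       e inj r t≈ (n , p) =
    n , equivariant-approx X φ i e n inj r t≈ p
  equivariant (var X)     i       e inj r t≈ p = e X inj r t≈ p

  equivariant-approx X φ {Δ} i e (suc n) = equivariant φ i
    (update (λ F _ → Equivariant Δ F) {ρ′ = ∅} X {G = ∅ X} (equivariant-approx X φ i e n) e)

  -- Consequences of the restrictions match and det.

  -- The mode lets one construction of residuals serve three fragments.
  data Mode : Set where
    free match det : Mode

  Restricted : Mode → Class
  Restricted free  = U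
  Restricted match = Match
  Restricted det   = Det

  restrict : ∀ μ {φ χ} → φ ◁ χ → Restricted μ χ → Restricted μ φ
  restrict free  s _       = _
  restrict match s m       = λ p → m (p ◅◅ s ◅ ε)
  restrict det   s (m , d) = (λ p → m (p ◅◅ s ◅ ε)) , (λ p → d (p ◅◅ s ◅ ε))

  current : ∀ μ {x φ} → Restricted μ (∃′ x ∙ φ) → μ ≡ free ⊎ MatchBody x φ
  current free  _       = inj₁ refl
  current match m       = inj₂ (m ε)
  current det   (m , _) = inj₂ (m ε)

  lookup-here : ∀ δ x d → lookup (δ [ x ↦ d ]) x ≡ just d
  lookup-here δ x d with x ≟ x
  ... | yes _  = refl
  ... | no x≢x = contradiction refl x≢x

  current-head : ∀ {x c δ d t} → IsCurrent x c →
                 Holds ((δ [ x ↦ d ]) [⋆↦ head t ]) c → d ≡ head t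
  current-head {x} {δ = δ} {d} x=⋆ (_ , p , refl) =
    just-injective (trans (sym (lookup-here δ x d)) p)
  current-head {x} {δ = δ} {d} ⋆=x (_ , refl , p) =
    just-injective (trans (sym (lookup-here δ x d)) p)

  -- Under `match` the witness of a quantifier is forced, so only data read from the trace are ever
  -- stored.
  match-head : ∀ {x φ ρ δ d t} → MatchBody x φ →
               eval φ ρ (δ [ x ↦ d ]) t → d ≡ head t
  match-head {t = t} (matchBody cur) ((h , _) , _) = current-head {t = t} cur h

  Covers : Pred 𝔻 0ℓ → List DVar → DEnv → Set
  Covers A Δ δ = ∀ {x} → x ∈ Δ → ∃[ d ] lookup δ x ≡ just d × A d

  covers-∷ : ∀ {A Δ δ d} x → A d → Covers A Δ δ → Covers A (x ∷ Δ) (δ [ x ↦ d ])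
  covers-∷ {d = d} x a c {y} y∈ with y ≟ x | y∈
  ... | yes _  | _         = d , refl , a
  ... | no y≢x | here y≡x  = contradiction y≡x y≢x
  ... | no _   | there y∈Δ = c y∈Δ

  pointwise-++⁻ : ∀ {a b r} {A : Set a} {B : Set b} {R : A → B → Set r} ys {zs xs} →
    Pointwise R xs (ys ++ zs) →
    ∃[ us ] ∃[ vs ] xs ≡ us ++ vs × Pointwise R us ys × Pointwise R vs zs
  pointwise-++⁻ []       rs       = [] , _ , refl , [] , rs
  pointwise-++⁻ (y ∷ ys) (r ∷ rs) with us , vs , refl , ss , ss′ ← pointwise-++⁻ ys rs =
    _ ∷ us , vs , refl , r ∷ ss , ss′

  allPairs-++⁻ : ∀ {a r} {A : Set a} {R : A → A → Set r} {x y} xs {ys} →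
    AllPairs R (xs ++ ys) → x ∈ xs → y ∈ ys → R x y
  allPairs-++⁻ (x ∷ xs) (r ∷ rs) (here refl) y∈ = All.lookup r (∈-++⁺ʳ xs y∈)
  allPairs-++⁻ (x ∷ xs) (r ∷ rs) (there x∈)  y∈ = allPairs-++⁻ xs rs x∈ y∈

  -- All branches bind the same `x`, and to the current datum, so their guards can be compared in
  -- one environment.
  branch : ∀ φ {x bs Δ Γ ρ δ t} → Pointwise (DetBranch x) bs (disjuncts φ) →
    FormulaIn Δ Γ φ → eval φ ρ δ t →
    ∃[ b ] b ∈ bs × ConstraintIn (x ∷ Δ) b × Holds ((δ [ x ↦ head t ]) [⋆↦ head t ]) b
  branch (φ ∨ ψ) ds (i , j) p with pointwise-++⁻ (disjuncts φ) ds
  branch (φ ∨ ψ) ds (i , j) (inj₁ p) | us , vs , refl , ds₁ , _ =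
    let b , b∈ , r = branch φ ds₁ i p in b , ∈-++⁺ˡ b∈ , r
  branch (φ ∨ ψ) ds (i , j) (inj₂ p) | us , vs , refl , _ , ds₂ =
    let b , b∈ , r = branch ψ ds₂ j p in b , ∈-++⁺ʳ us b∈ , r
  branch (∃′ x ∙ _) {bs = b ∷ []} {δ = δ} {t} (detBranch cur ∷ [])
    ((_ , i) , _) (d , (h , h′) , _) =
    b , here refl , i ,
    subst (λ e → Holds ((δ [ x ↦ e ]) [⋆↦ head t ]) b) (current-head {t = t} cur h) h′
  branch tt          (() ∷ _)
  branch ff          (() ∷ _)
  branch (⟨ _ ⟩ _)   (() ∷ _)
  branch ([ _ ] _)   (() ∷ _)
  branch (∀′ _ ∙ _)  (() ∷ _)
  branch (_ ∧ _)     (() ∷ _)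
  branch (min _ ∙ _) (() ∷ _)
  branch (max _ ∙ _) (() ∷ _)
  branch (var _)     (() ∷ _)

  -- Guards depend only on the environment and the current datum, hence traces with equal heads
  -- cannot take different disjuncts.
  exclusive : ∀ {φ ψ A Δ Γ ρ ρ′ δ t t′} → DetDisjunction (φ ∨ ψ) →
    FormulaIn Δ Γ (φ ∨ ψ) → Covers A Δ δ → head t′ ≡ head t →
    eval φ ρ δ t → eval ψ ρ′ δ t′ → ⊥
  exclusive {φ} {ψ} {Δ = Δ} {δ = δ} {t} {t′} (x , bs , ds , unsat) (i , j) cov t≈ p q
    with us , vs , refl , ds₁ , ds₂ ← pointwise-++⁻ (disjuncts φ) ds
    with b , b∈ , ib , hb ← branch φ {t = t} ds₁ i p
    with c , c∈ , ic , hc ← branch ψ {t = t′} ds₂ j q =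
    allPairs-++⁻ us unsat b∈ c∈ w (total b ib hb , total c ic hc′)
    where
    v : Valuation
    v = (δ [ x ↦ head t ]) [⋆↦ head t ]
    cov′ : Covers U Δ δ
    cov′ x∈Δ = let d , eq , _ = cov x∈Δ in d , eq , _
    -- `Unsatisfiable` ranges over total valuations, so `v` is completed by a default value; on the
    -- variables in scope it is already defined.
    w : DTerm → 𝔻
    w e = Maybe.fromMaybe (head t) (v e)
    defined : ∀ {m : Maybe 𝔻} {d e} → m ≡ just e →
              just (Maybe.fromMaybe d m) ≡ Maybe.map id m
    defined refl = refl
    w≈ : ∀ e → TermIn (x ∷ Δ) e → just (w e) ≡ Maybe.map id (v e)
    w≈ (` y) y∈ = defined (proj₁ (proj₂ (covers-∷ {U} {δ = δ} {head t} x _ cov′ y∈)))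
    w≈ ⋆     _  = refl
    total : ∀ b → ConstraintIn (x ∷ Δ) b → Holds v b → Holds (just ∘ w) b
    total b i = proj₁ (Holds-rename {π = id} id w≈ b i)
    hc′ : Holds v c
    hc′ = subst (λ d → Holds ((δ [ x ↦ d ]) [⋆↦ d ]) c) t≈ hc

  -- Residuals after a finite prefix.

  drop : ℕ → Trc → Trc
  drop m t i = t (m + i)

  -- Quantifier depth: `length Δ + rank φ` does not grow on passing to a subformula, which bounds
  -- the number of remembered data.
  rank : Formula → ℕ
  rank tt          = 0
  rank ff          = 0
  rank (⟨ b ⟩ φ)   = rank φ
  rank ([ b ] φ)   = rank φ
  rank (∃′ x ∙ φ)  = suc (rank φ)
  rank (∀′ x ∙ φ)  = suc (rank φ)
  rank (φ ∨ ψ)     = rank φ ⊔ rank ψ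
  rank (φ ∧ ψ)     = rank φ ⊔ rank ψ
  rank (min X ∙ φ) = rank φ
  rank (max X ∙ φ) = rank φ
  rank (var X)     = 0

  Existential : Class
  Existential = BuiltFrom (minᶜ ∷ ∃ᶜ ∷ ⟨⟩ᶜ ∷ ∨ᶜ ∷ [])

  -- `A` is the set of data that may be remembered: everything when quantifiers may guess, otherwise
  -- a set containing the data read so far.
  module Residuals (K : ℕ) (μ : Mode) (A : Pred 𝔻 0ℓ) (arbitrary : μ ≡ free → ∀ d → A d) where

    -- A configuration of the register automaton behind a formula, seen
    -- through the set of suffixes that it accepts: after reading m data, the
    -- formula remembers only the data in the support.

    record Residual (S : Pred Trc 0ℓ) (m : ℕ) (t : Trc) : Set₁ where
      field
        P         : Pred Trc 0ℓ
        support   : List 𝔻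
        small     : length support ≤ K
        allowed   : ∀ {d} → d ∈ support → A d
        supported : ∀ {π} → Injective _≡_ _≡_ π → (∀ {d} → d ∈ support → π d ≡ d) →
                    ∀ {u u′ : Trc} → (∀ i → u′ i ≡ π (u i)) → P u → P u′
        holds     : P (drop m t)
        sound     : ∀ {t′} → Agree m t t′ → P (drop m t′) → S t′
        complete  : μ ≡ det → ∀ {t′} → Agree m t t′ → S t′ → P (drop m t′)

    transfer : ∀ {S S′ m t} → (∀ {t′} → Agree m t t′ → S t′ → S′ t′) →
               (μ ≡ det → ∀ {t′} → Agree m t t′ → S′ t′ → S t′) →
               Residual S m t → Residual S′ m t
    transfer to from r = record
      { Residual r
      ; sound    = λ a p → to a (Residual.sound r a p)
      ; complete = λ μ≡ a s → Residual.complete r μ≡ a (from μ≡ a s)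
      }

    later : ∀ {S m t} → Residual S m (tail t) → Residual (S ∘ tail) (suc m) t
    later r = record
      { Residual r
      ; sound    = λ a → Residual.sound r (agree-tail a)
      ; complete = λ μ≡ a → Residual.complete r μ≡ (agree-tail a)
      }

    -- Before anything is read the residual is the set itself. A renaming that fixes the values of
    -- `Δ` takes the environment to itself, so these values form a support.
    initial : ∀ {Δ F δ t} → Equivariant Δ F → Covers A Δ δ → length Δ ≤ K →
              F δ t → Residual (F δ) 0 t
    initial {Δ} {F} {δ} e cov Δ≤K p = record
      { P         = F δ
      ; support   = mapWith∈ Δ value
      ; small     = subst (_≤ K) (sym (length-mapWith∈ (setoid DVar) Δ)) Δ≤K
      ; allowed   = λ d∈ → let x , x∈Δ , d≡ = mapWith∈⁻ Δ value d∈ in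
                      subst A (sym d≡) (proj₂ (proj₂ (cov x∈Δ)))
      ; supported = λ {π} inj fixed → e inj (renames π fixed)
      ; holds     = p
      ; sound     = λ _ q → q
      ; complete  = λ _ _ q → q
      }
      where
      value : ∀ {x} → x ∈ Δ → 𝔻
      value x∈Δ = proj₁ (cov x∈Δ)
      renames : ∀ π → (∀ {d} → d ∈ mapWith∈ Δ value → π d ≡ d) → Renames π Δ δ δ
      renames π fixed x∈Δ with d , eq , _ ← cov x∈Δ in cov≡ =
        trans eq (sym (trans (cong (Maybe.map π) eq) (cong just
          (fixed (mapWith∈⁺ value (_ , x∈Δ , cong proj₁ (sym cov≡)))))))

    -- Comparing two environments, the smaller of which interprets recursion
    -- variables by approximations, lets the residuals at a least fixed point
    -- be residuals of the fixed point itself.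

    Traceable : List DVar → Interp → Interp → Set₁
    Traceable Δ F₀ F = ∀ m {δ t} → Covers A Δ δ → (∀ {i} → i < m → A (t i)) →
                       F₀ δ t → Residual (F δ) m t

    traceable-∷ : ∀ {Δ F₀ F} x → Traceable Δ F₀ F → Traceable (x ∷ Δ) F₀ F
    traceable-∷ x r m cov = r m (cov ∘ there)

    record _≼[_]_ (ρ₀ : TEnv) (Δ : List DVar) (ρ : TEnv) : Set₁ where
      field
        below : ρ₀ ⊆ᵉ ρ
        equiv : ∀ X → Equivariant Δ (ρ X)
        trace : ∀ X → Traceable Δ (ρ₀ X) (ρ X)
    open _≼[_]_

    ≼-∷ : ∀ {ρ₀ Δ ρ} x → ρ₀ ≼[ Δ ] ρ → ρ₀ ≼[ x ∷ Δ ] ρ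
    ≼-∷ x ρ≼ = record
      { below = below ρ≼
      ; equiv = λ X → equivariant-∷ x (equiv ρ≼ X)
      ; trace = λ X → traceable-∷ x (trace ρ≼ X)
      }

    -- By induction on the formula and, at a fixed point, on the stage that accepts the trace. A
    -- modality consumes one datum; once the prefix is used up, the current subformula in its
    -- environment is the residual.
    residual : ∀ φ {Δ Γ ρ₀ ρ} → FormulaIn Δ Γ φ → Existential φ → Restricted μ φ →
               length Δ + rank φ ≤ K → ρ₀ ≼[ Δ ] ρ → Traceable Δ (eval φ ρ₀) (eval φ ρ)
    residual-approx : ∀ X φ {Δ Γ ρ₀ ρ} → FormulaIn Δ (X ∷ Γ) φ → Existential φ →
               Restricted μ φ → length Δ + rank φ ≤ K → ρ₀ ≼[ Δ ] ρ →
               ∀ n → Traceable Δ (approx X φ ρ₀ n) (eval (min X ∙ φ) ρ)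

    residual φ i _ _ k ρ≼ zero cov _ p =
      initial (equivariant φ i (equiv ρ≼)) cov (m+n≤o⇒m≤o _ k) (mono φ (below ρ≼) _ p)
    residual tt i _ _ k ρ≼ (suc m) {δ} {t} cov seen p =
      record
      { Residual (initial {F = λ _ _ → ⊤} {δ} {t} (λ _ _ _ q → q) cov (m+n≤o⇒m≤o _ k) _)
      ; sound    = λ _ _ → _
      ; complete = λ _ _ _ → _
      }
    residual (⟨ b ⟩ φ) (_ , i) (_ , c) r k ρ≼ (suc m) {δ} cov seen (h , p) =
      transfer (λ a q → subst (λ d → Holds (δ [⋆↦ d ]) b) (sym (a z<s)) h , q)
               (λ _ a → proj₂)
               (later (residual φ i c (restrict μ ⟨⟩◁ r) k ρ≼ m cov (seen ∘ s<s) p))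
    residual (∃′ x ∙ φ) {Δ} {ρ = ρ} i (_ , c) r k ρ≼ (suc m) {δ} {t} cov seen (d , p) =
      transfer (λ _ q → d , q) functional
               (residual φ i c (restrict μ ∃◁ r) (subst (_≤ K) (+-suc (length Δ) _) k)
                 (≼-∷ x ρ≼) (suc m) (covers-∷ x allowed cov) seen p)
      where
      allowed : A d
      allowed with current μ r
      ... | inj₁ μ≡ = arbitrary μ≡ d
      ... | inj₂ mb = subst A (sym (match-head mb p)) (seen z<s)
      -- Both witnesses are the heads of their traces, and these agree because the prefix is
      -- nonempty.
      functional : μ ≡ det → ∀ {t′} → Agree (suc m) t t′ →
                   eval (∃′ x ∙ φ) ρ δ t′ → eval φ ρ (δ [ x ↦ d ]) t′
      functional refl {t′} a (d′ , q) with current det r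
      ... | inj₂ mb = subst (λ e → eval φ ρ (δ [ x ↦ e ]) t′)
        (trans (match-head mb q) (trans (a z<s) (sym (match-head mb p)))) q
    residual (φ ∨ ψ) {Δ} (i , j) (_ , c , _) r k ρ≼ (suc m) {δ} {t} cov seen (inj₁ p) =
      transfer (λ _ → inj₁)
               -- Under `det` a trace with the same head cannot satisfy the other disjunct.
               (λ { refl a (inj₁ q) → q
                  ; refl a (inj₂ q) → ⊥-elim
                      (exclusive {φ} {ψ} (proj₂ r ε) (i , j) cov (a z<s) p q) })
               (residual φ i c (restrict μ ∨◁ˡ r)
                 (≤-trans (+-monoʳ-≤ (length Δ) (m≤m⊔n _ _)) k) ρ≼ (suc m) cov seen p)
    residual (φ ∨ ψ) {Δ} (i , j) (_ , _ , c) r k ρ≼ (suc m) {δ} {t} cov seen (inj₂ p) =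
      transfer (λ _ → inj₂)
               (λ { refl a (inj₁ q) → ⊥-elim
                      (exclusive {φ} {ψ} (proj₂ r ε) (i , j) cov (sym (a z<s)) q p)
                  ; refl a (inj₂ q) → q })
               (residual ψ j c (restrict μ ∨◁ʳ r)
                 (≤-trans (+-monoʳ-≤ (length Δ) (m≤n⊔m (rank φ) _)) k) ρ≼ (suc m) cov seen p)
    residual (min X ∙ φ) i (_ , c) r k ρ≼ m@(suc _) cov seen (n , p) =
      residual-approx X φ i c (restrict μ min◁ r) k ρ≼ n m cov seen p
    residual (var X) i _ _ k ρ≼ m@(suc _) cov seen p = trace ρ≼ X m cov seen p
    residual (φ ∧ ψ) i (there (there (there (there ()))) , _)

    residual-approx X φ {Δ} {ρ₀ = ρ₀} {ρ} i c r k ρ≼ (suc n) m cov seen p =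
      transfer (λ _ → fold X φ ρ _) (λ _ _ → unfold X φ ρ _)
               (residual φ i c r k ρ≼′ m cov seen p)
      where
      ρ≼′ : (ρ₀ [ X ↦ᵢ approx X φ ρ₀ n ]) ≼[ Δ ] (ρ [ X ↦ᵢ eval (min X ∙ φ) ρ ])
      ρ≼′ = record
        { below = update _⊑ᵢ_ X (λ δ q → n , approx-mono X φ (below ρ≼) n δ q) (below ρ≼)
        ; equiv = update (λ F _ → Equivariant Δ F) {ρ′ = ∅} X {G = ∅ X}
                    (equivariant (min X ∙ φ) i (equiv ρ≼)) (equiv ρ≼)
        ; trace = update (Traceable Δ) X (residual-approx X φ i c r k ρ≼ n) (trace ρ≼)
        }

    residual₀ : ∀ ψ → Closed ψ → Existential ψ → Restricted μ ψ → rank ψ ≤ K →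
                ∀ m {t} → (∀ {i} → i < m → A (t i)) → lang ψ t → Residual (lang ψ) m t
    residual₀ ψ closed ex r k m = residual ψ closed ex r k
      (record { below = λ _ _ p → p ; equiv = λ { _ _ _ _ () } ; trace = λ { _ _ _ _ () } })
      m (λ ())

  existential⇒positive : ∀ φ → Existential φ → Positive φ
  existential⇒positive = built-from-mono ∈-++⁺ˡ

  -- Checking match and det on concrete formulae.

  -- Defined by recursion rather than through `_◁*_`, so that on a concrete formula it unfolds to a
  -- tuple of local conditions.
  AllSub : Class → Class
  AllSub Q tt          = Q tt
  AllSub Q ff          = Q ff
  AllSub Q (⟨ b ⟩ φ)   = Q (⟨ b ⟩ φ) × AllSub Q φ
  AllSub Q ([ b ] φ)   = Q ([ b ] φ) × AllSub Q φ
  AllSub Q (∃′ x ∙ φ)  = Q (∃′ x ∙ φ) × AllSub Q φ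
  AllSub Q (∀′ x ∙ φ)  = Q (∀′ x ∙ φ) × AllSub Q φ
  AllSub Q (φ ∨ ψ)     = Q (φ ∨ ψ) × AllSub Q φ × AllSub Q ψ
  AllSub Q (φ ∧ ψ)     = Q (φ ∧ ψ) × AllSub Q φ × AllSub Q ψ
  AllSub Q (min X ∙ φ) = Q (min X ∙ φ) × AllSub Q φ
  AllSub Q (max X ∙ φ) = Q (max X ∙ φ) × AllSub Q φ
  AllSub Q (var X)     = Q (var X)

  allSub-self : ∀ {Q : Class} φ → AllSub Q φ → Q φ
  allSub-self tt          q       = q
  allSub-self ff          q       = q
  allSub-self (⟨ b ⟩ φ)   (q , _) = q
  allSub-self ([ b ] φ)   (q , _) = q
  allSub-self (∃′ x ∙ φ)  (q , _) = q
  allSub-self (∀′ x ∙ φ)  (q , _) = q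
  allSub-self (φ ∨ ψ)     (q , _) = q
  allSub-self (φ ∧ ψ)     (q , _) = q
  allSub-self (min X ∙ φ) (q , _) = q
  allSub-self (max X ∙ φ) (q , _) = q
  allSub-self (var X)     q       = q

  allSub-◁ : ∀ {Q : Class} {φ χ} → φ ◁ χ → AllSub Q χ → AllSub Q φ
  allSub-◁ ⟨⟩◁  (_ , q)     = q
  allSub-◁ []◁  (_ , q)     = q
  allSub-◁ ∃◁   (_ , q)     = q
  allSub-◁ ∀◁   (_ , q)     = q
  allSub-◁ ∨◁ˡ  (_ , q , _) = q
  allSub-◁ ∨◁ʳ  (_ , _ , q) = q
  allSub-◁ ∧◁ˡ  (_ , q , _) = q
  allSub-◁ ∧◁ʳ  (_ , _ , q) = q
  allSub-◁ min◁ (_ , q)     = q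
  allSub-◁ max◁ (_ , q)     = q

  allSub-◁* : ∀ {Q : Class} {φ χ} → φ ◁* χ → AllSub Q χ → AllSub Q φ
  allSub-◁* ε       q = q
  allSub-◁* (s ◅ p) q = allSub-◁ s (allSub-◁* p q)

  allSub-elim : ∀ (Q : Class) {φ χ} → AllSub Q χ → φ ◁* χ → Q φ
  allSub-elim Q {φ} q p = allSub-self {Q} φ (allSub-◁* p q)

  LocalMatch LocalDet : Class
  LocalMatch (∃′ x ∙ φ) = MatchBody x φ
  LocalMatch _          = ⊤
  LocalDet (φ ∨ ψ)      = DetDisjunction (φ ∨ ψ)
  LocalDet φ            = LocalMatch φ

  match-intro : ∀ {χ} → AllSub LocalMatch χ → Match χ
  match-intro q p = allSub-elim LocalMatch q p

  det-intro : ∀ {χ} → AllSub LocalDet χ → Det χ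
  det-intro q = (λ p → allSub-elim LocalDet q p) , (λ p → allSub-elim LocalDet q p)

-- Fresh data, transpositions and the test traces.

module Separation (𝔻 : Set) (𝔻↔ℕ : 𝔻 ↔ ℕ) where

  open Semantics 𝔻
  open Evaluation 𝔻

  d : ℕ → 𝔻
  d = Inverse.from 𝔻↔ℕ

  d-injective : Injective _≡_ _≡_ d
  d-injective = Injection.injective (↔⇒↣ (↔-sym 𝔻↔ℕ))

  _≟ᵈ_ : DecidableEquality 𝔻
  _≟ᵈ_ = via-injection (↔⇒↣ 𝔻↔ℕ) _≟_

  open DecMembership _≟ᵈ_ using (_∈?_)

  -- By the pigeonhole principle, `suc (length σ)` distinct data cannot all occupy positions of `σ`.
  fresh : ∀ σ s → ∃[ i ] s ≤ i × i ≤ s + length σ × d i ∉ σ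
  fresh σ s =
    let i , d∉σ = ¬∀⟶∃¬ (suc (length σ)) (λ i → d (s + toℕ i) ∈ σ) (λ i → _ ∈? σ) clash
    in s + toℕ i , m≤m+n s _ , +-monoʳ-≤ s (toℕ≤pred[n] i) , d∉σ
    where
    clash : ¬ (∀ i → d (s + toℕ {suc (length σ)} i) ∈ σ)
    clash d∈σ with i , j , i<j , eq ← pigeonhole (n<1+n _) (index ∘ d∈σ) =
      <⇒≢ i<j (+-cancelˡ-≡ s _ _ (d-injective (begin
        d (s + toℕ i)                  ≡⟨ lookup-index (d∈σ i) ⟩
        List.lookup σ (index (d∈σ i))  ≡⟨ cong (List.lookup σ) eq ⟩
        List.lookup σ (index (d∈σ j))  ≡⟨ lookup-index (d∈σ j) ⟨
        d (s + toℕ j)                  ∎)))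
      where open ≡-Reasoning

  swap : 𝔻 → 𝔻 → 𝔻 → 𝔻
  swap a b v with v ≟ᵈ a | v ≟ᵈ b
  ... | yes _ | _     = b
  ... | no _  | yes _ = a
  ... | no _  | no _  = v

  swap-left : ∀ a b → swap a b a ≡ b
  swap-left a b with a ≟ᵈ a | a ≟ᵈ b
  ... | yes _  | _ = refl
  ... | no a≢a | _ = contradiction refl a≢a

  swap-right : ∀ a b → swap a b b ≡ a
  swap-right a b with b ≟ᵈ a | b ≟ᵈ b
  ... | yes b≡a | _      = b≡a
  ... | no _    | yes _  = refl
  ... | no _    | no b≢b = contradiction refl b≢b

  swap-other : ∀ {a b v} → v ≢ a → v ≢ b → swap a b v ≡ v
  swap-other {a} {b} {v} v≢a v≢b with v ≟ᵈ a | v ≟ᵈ b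
  ... | yes v≡a | _       = contradiction v≡a v≢a
  ... | no _    | yes v≡b = contradiction v≡b v≢b
  ... | no _    | no _    = refl

  swap-involutive : ∀ a b v → swap a b (swap a b v) ≡ v
  swap-involutive a b v with v ≟ᵈ a | v ≟ᵈ b
  ... | yes refl | _        = swap-right a b
  ... | no _     | yes refl = swap-left a b
  ... | no v≢a   | no v≢b   = swap-other v≢a v≢b

  swap-injective : ∀ a b → Injective _≡_ _≡_ (swap a b)
  swap-injective a b {u} {v} eq = trans (sym (swap-involutive a b u))
    (trans (cong (swap a b) eq) (swap-involutive a b v))

  swap-fixes : ∀ {a b σ} → a ∉ σ → b ∉ σ → ∀ {v} → v ∈ σ → swap a b v ≡ v
  swap-fixes a∉ b∉ v∈ = swap-other (λ { refl → a∉ v∈ }) (λ { refl → b∉ v∈ })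

  -- Opaque, so that their arguments can be inferred from equations.

  opaque
    rise : ℕ → ℕ → ℕ
    rise N k with k ≤? N
    ... | yes _ = k
    ... | no  _ = 0

    bump : ℕ → ℕ → ℕ → ℕ → ℕ
    bump N j i k with k ≟ j
    ... | yes _ = i
    ... | no  _ = rise N k

    rise-low : ∀ {N k} → k ≤ N → rise N k ≡ k
    rise-low {N} {k} k≤N with k ≤? N
    ... | yes _  = refl
    ... | no k≰N = contradiction k≤N k≰N

    rise-high : ∀ {N k} → N < k → rise N k ≡ 0
    rise-high {N} {k} N<k with k ≤? N
    ... | yes k≤N = contradiction k≤N (<⇒≱ N<k)
    ... | no  _   = refl

    rise-cases : ∀ N k → rise N k ≡ k × k ≤ N ⊎ rise N k ≡ 0 × N < k
    rise-cases N k with k ≤? N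
    ... | yes k≤N = inj₁ (refl , k≤N)
    ... | no  k≰N = inj₂ (refl , ≰⇒> k≰N)

    bump-at : ∀ N j i → bump N j i j ≡ i
    bump-at N j i with j ≟ j
    ... | yes _  = refl
    ... | no j≢j = contradiction refl j≢j

    bump-off : ∀ {N j i k} → k ≢ j → bump N j i k ≡ rise N k
    bump-off {j = j} {k = k} k≢j with k ≟ j
    ... | yes k≡j = contradiction k≡j k≢j
    ... | no  _   = refl

    -- Past position `i` the rise contains `j` once and `i` never, so writing `i` for that `j` is a
    -- transposition; `0 < i` protects the final zeros.
    bump-swap : ∀ {N j i k} → 0 < i → i < j → j ≤ N → i < k →
                d (bump N j i k) ≡ swap (d i) (d j) (d (rise N k))
    bump-swap {N} {j} {i} {k} 0<i i<j j≤N i<k with k ≟ j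
    ... | yes refl rewrite rise-low j≤N = sym (swap-right (d i) (d j))
    ... | no k≢j with rise-cases N k
    ...   | inj₁ (eq , _) rewrite eq = sym (swap-other
      (λ e → <⇒≢ i<k (sym (d-injective e))) (λ e → k≢j (d-injective e)))
    ...   | inj₂ (eq , _) rewrite eq = sym (swap-other
      (λ e → <⇒≢ 0<i (d-injective e)) (λ e → <⇒≢ (<-trans 0<i i<j) (d-injective e)))

  rise-swap : ∀ {N j i k} → 0 < i → i < j → j ≤ N → i < k →
              d (rise N k) ≡ swap (d i) (d j) (d (bump N j i k))
  rise-swap {N} {j} {i} {k} 0<i i<j j≤N i<k =
    trans (sym (swap-involutive (d i) (d j) _))
          (cong (swap (d i) (d j)) (sym (bump-swap 0<i i<j j≤N i<k)))

  Rise : ℕ → Trc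
  Rise N = d ∘ rise N

  Bump : ℕ → ℕ → ℕ → Trc
  Bump N j i = d ∘ bump N j i

  -- The separating formulae.

  x y z : DVar
  x = 0
  y = 1
  z = 2

  X : FVar
  X = 0

  equal : ∀ {m : Maybe 𝔻} {h v} → m ≡ just v →
          (∃[ e ] just h ≡ just e × m ≡ just e) → h ≡ v
  equal m≡v (_ , refl , m≡h) = just-injective (trans (sym m≡h) m≡v)

  -- With `i + k` as the index, instances at 0 and 1 speak of `t k` and `t (suc k)` by computation.
  Suffix : ℕ → Trc → Trc → Set
  Suffix k t u = ∀ i → u i ≡ t (i + k)

  suffix-suc : ∀ k t {u} → Suffix k (tail t) u → Suffix (suc k) t u
  suffix-suc k t s i = trans (s i) (cong t (sym (+-suc i k)))

  -- The strong until of linear temporal logic. The binder captures `X` in `φ`, so the two rules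
  -- below evaluate `φ` in an unspecified trace environment.
  Until : Constraint → Formula → Formula
  Until b φ = min X ∙ φ ∨ ⟨ b ⟩ var X

  until⇒ : ∀ {b φ ρ δ t} → eval (Until b φ) ρ δ t →
    ∃[ k ] ∃[ u ] ∃[ ρ′ ] (∀ {i} → i < k → Holds (δ [⋆↦ t i ]) b) × Suffix k t u × eval φ ρ′ δ u
  until⇒ {b} {φ} {ρ} {δ} (n , p) = go n p
    where
    go : ∀ n {t} → approx X (φ ∨ ⟨ b ⟩ var X) ρ n δ t →
      ∃[ k ] ∃[ u ] ∃[ ρ′ ] (∀ {i} → i < k → Holds (δ [⋆↦ t i ]) b) × Suffix k t u × eval φ ρ′ δ u
    go (suc n) {t} (inj₁ p)       =
      0 , _ , _ , (λ ()) , (λ i → cong t (sym (+-identityʳ i))) , p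
    go (suc n) {t} (inj₂ (h , p)) with k , u , ρ′ , hs , s , q ← go n p =
      suc k , u , ρ′ , (λ { {zero} _ → h ; {suc i} i<k → hs (s<s⁻¹ i<k) }) , suffix-suc k t s , q

  until⇐ : ∀ {b φ ρ δ t} k → (∀ {i} → i < k → Holds (δ [⋆↦ t i ]) b) →
    (∀ {u ρ′} → Suffix k t u → eval φ ρ′ δ u) → eval (Until b φ) ρ δ t
  until⇐ {b} {φ} {ρ} {δ} {t} zero    hs p =
    fold X (φ ∨ ⟨ b ⟩ var X) ρ δ (inj₁ (p (λ i → cong t (sym (+-identityʳ i)))))
  until⇐ {b} {φ} {ρ} {δ} {t} (suc k) hs p =
    fold X (φ ∨ ⟨ b ⟩ var X) ρ δ
      (inj₂ (hs z<s , until⇐ k (hs ∘ s<s) (p ∘ suffix-suc k t)))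

  -- The quantifier over `y` gives both branches the shape that `det` asks for; their guards are
  -- complementary.
  recurs-body recurs : Formula
  recurs-body = (∃′ y ∙ ⟨ ⋆ == ` y & ⋆ == ` x ⟩ tt)
              ∨ (∃′ y ∙ ⟨ ⋆ == ` y & ~ (⋆ == ` x) ⟩ var X)
  recurs = ∃′ x ∙ ⟨ ⋆ == ` x & true ⟩ (min X ∙ recurs-body)

  recurs⇒ : ∀ t → lang recurs t → ∃[ k ] t (suc k) ≡ t 0
  recurs⇒ t (_ , ((_ , refl , refl) , _) , n , p) = go n refl p
    where
    go : ∀ n {ρ δ v u} → lookup δ x ≡ just v → approx X recurs-body ρ n δ u → ∃[ k ] u k ≡ v
    go (suc n) δx (inj₁ (_ , (_ , e) , _)) = 0 , equal δx e
    go (suc n) δx (inj₂ (_ , _ , p))       = let k , e = go n δx p in suc k , e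

  -- `suc k` must be the first recurrence, since the loop continues only past data other than the
  -- first one.
  recurs⇐ : ∀ t k → t (suc k) ≡ t 0 → (∀ {i} → i < k → t (suc i) ≢ t 0) → lang recurs t
  recurs⇐ t k t≡ t≢ = t 0 , ((t 0 , refl , refl) , _) , go k refl t≡ t≢
    where
    go : ∀ k {ρ δ v u} → lookup δ x ≡ just v → u k ≡ v → (∀ {i} → i < k → u i ≢ v) →
         eval (min X ∙ recurs-body) ρ δ u
    go zero    {ρ} {δ} δx u≡ u≢ = fold X recurs-body ρ δ
      (inj₁ (_ , ((_ , refl , refl) , (_ , cong just u≡ , δx)) , _))
    go (suc k) {ρ} {δ} δx u≡ u≢ = fold X recurs-body ρ δ
      (inj₂ (_ , ((_ , refl , refl) , λ e → u≢ z<s (equal δx e)) , go k δx u≡ (u≢ ∘ s<s)))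

  repeats : Formula
  repeats = ∃′ z ∙ ⟨ ⋆ == ` z & true ⟩ Until true
    (∃′ x ∙ ⟨ ⋆ == ` x & ~ (⋆ == ` z) ⟩ Until true (⟨ ⋆ == ` x ⟩ tt))

  repeats⇒ : ∀ t → lang repeats t →
             ∃[ p ] ∃[ q ] t (suc p) ≢ t 0 × t (suc (suc q + p)) ≡ t (suc p)
  repeats⇒ t (_ , ((_ , refl , refl) , _) , w)
    with p , u , _ , _ , s , (_ , ((_ , refl , refl) , u≢) , w′) ← until⇒ w
    with q , u′ , _ , _ , s′ , (e , _) ← until⇒ w′ =
    p , q , (λ t≡ → u≢ (_ , cong just (trans (s 0) t≡) , refl)) ,
    trans (sym (s (suc q))) (trans (sym (s′ 0)) (trans (equal refl e) (s 0)))

  repeats⇐ : ∀ t p q → t (suc p) ≢ t 0 → t (suc (suc q + p)) ≡ t (suc p) → lang repeats t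
  repeats⇐ t p q t≢ t≡ = t 0 , ((_ , refl , refl) , _) , until⇐ p (λ _ → _) λ s →
    _ , ((_ , refl , refl) , λ e → t≢ (trans (sym (s 0)) (equal refl e))) ,
    until⇐ q (λ _ → _) λ s′ →
      (_ , refl , cong just (trans (s 0) (trans (sym t≡) (sym (trans (s′ 0) (s (suc q))))))) , _

  -- `x` is guessed before it is read, which `match` forbids; the until then makes the match its
  -- first occurrence.
  turns : Formula
  turns = ∃′ z ∙ ⟨ ⋆ == ` z & true ⟩ (∃′ x ∙ Until (~ (⋆ == ` x))
    (⟨ ⋆ == ` x & ~ (⋆ == ` z) ⟩ ⟨ ⋆ == ` z ⟩ tt))

  turns⇒ : ∀ t → lang turns t →
    ∃[ p ] (∀ {i} → i < p → t (suc i) ≢ t (suc p)) × t (suc p) ≢ t 0 × t (suc (suc p)) ≡ t 0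
  turns⇒ t (_ , ((_ , refl , refl) , _) , v , w)
    with p , u , _ , ≢v , s , ((e , u≢) , e′ , _) ← until⇒ w =
    p ,
    (λ i<p t≡ → ≢v i<p (_ , cong just (trans t≡ (trans (sym (s 0)) (equal refl e))) , refl)) ,
    (λ t≡ → u≢ (_ , cong just (trans (s 0) t≡) , refl)) ,
    trans (sym (s 1)) (equal refl e′)

  turns⇐ : ∀ t p → (∀ {i} → i < p → t (suc i) ≢ t (suc p)) → t (suc p) ≢ t 0 →
           t (suc (suc p)) ≡ t 0 → lang turns t
  turns⇐ t p new t≢ t≡ = t 0 , ((_ , refl , refl) , _) , t (suc p) ,
    until⇐ p (λ i<p e → new i<p (equal refl e)) λ s →
      ((_ , cong just (s 0) , refl) , λ e → t≢ (trans (sym (s 0)) (equal refl e))) ,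
      (_ , cong just (trans (s 1) t≡) , refl) , _

  -- The conjuncts read the same suffix separately: one continues the loop, the other checks that
  -- the datum just read stays absent until `z` returns.
  injects-body injects : Formula
  injects-body = ⟨ ⋆ == ` z ⟩ tt
    ∨ (∃′ x ∙ ⟨ ⋆ == ` x ⟩ (var X ∧ Until (~ (⋆ == ` x)) (⟨ ⋆ == ` z ⟩ tt)))
  injects = ∃′ z ∙ ⟨ ⋆ == ` z & true ⟩ (min X ∙ injects-body)

  injects⇐ : ∀ t k → t (suc k) ≡ t 0 →
    (∀ {i j} → i < j → j ≤ k → t i ≢ t j) → lang injects t
  injects⇐ t k t≡ t≢ = t 0 , ((_ , refl , refl) , _) ,
    go k refl t≡ (λ i<k e → t≢ z<s i<k (sym e)) (λ i<j j<k → t≢ (s<s i<j) j<k)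
    where
    go : ∀ k {ρ δ u v} → lookup δ z ≡ just v → u k ≡ v → (∀ {i} → i < k → u i ≢ v) →
         (∀ {i j} → i < j → j < k → u i ≢ u j) → eval (min X ∙ injects-body) ρ δ u
    go zero    {ρ} {δ} δz u≡ _ _ =
      fold X injects-body ρ δ (inj₁ ((_ , cong just u≡ , δz) , _))
    go (suc k) {ρ} {δ} {u} δz u≡ u≢ new = fold X injects-body ρ δ (inj₂ (u 0 , (_ , refl , refl) ,
      go k δz u≡ (u≢ ∘ s<s) (λ i<j j<k → new (s<s i<j) (s<s j<k)) ,
      until⇐ k (λ i<k e → new z<s (s<s i<k) (sym (equal refl e))) λ s →
        (_ , cong just (trans (s 0) u≡) , δz) , _))

  -- Follow the loop to position `i`: either it has already stopped at the first datum, or the until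
  -- started there cannot pass position `j` before that datum returns.
  injects⇒ : ∀ t → lang injects t → ∀ {i j} → i < j → t (suc i) ≡ t (suc j) →
             ∃[ k ] k ≤ j × t (suc k) ≡ t 0
  injects⇒ t (_ , ((_ , refl , refl) , _) , p) {i} = go i refl p
    where
    go : ∀ i {ρ δ u v j} → lookup δ z ≡ just v → eval (min X ∙ injects-body) ρ δ u →
         i < j → u i ≡ u j → ∃[ k ] k ≤ j × u k ≡ v
    go i {ρ} {δ} δz p i<j u≡ with unfold X injects-body ρ δ p
    ... | inj₁ (e , _) = 0 , z≤n , equal δz e
    go (suc i) δz p (s≤s i<j) u≡ | inj₂ (_ , _ , p′ , _) =
      let k , k≤j , e = go i δz p′ i<j u≡ in suc k , s≤s k≤j , e
    go zero {j = suc j} δz p _ u≡ | inj₂ (_ , (_ , refl , refl) , _ , w)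
      with k , u′ , _ , u≢ , s , (e , _) ← until⇒ w
      with k ≤? j
    ... | yes k≤j = suc k , s≤s k≤j , trans (sym (s 0)) (equal δz e)
    ... | no  k≰j = contradiction (_ , cong just (sym u≡) , refl) (u≢ (≰⇒> k≰j))

  exhausts-body exhausts : Formula
  exhausts-body = Until true (⟨ ⋆ == ` x ⟩ tt)
  exhausts = ∀′ x ∙ exhausts-body

  -- The interpretation of `exhausts` is written out by hand, since `eval` is empty on `∀′`.
  Exhausting : Interp
  Exhausting δ t = ∀ v → eval exhausts-body ∅ (δ [ x ↦ v ]) t

  exhausts-body-positive : Positive exhausts-body
  exhausts-body-positive = #0 , #3 , (#2 , _) , #2 , inj₁ #0

  exhausts-correct : ⟦ exhausts ⟧ ∅ Exhausting
  exhausts-correct = _ , eval-correct exhausts-body exhausts-body-positive , λ δ → id , id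

  exhausting⇒ : ∀ t → Exhausting [] t → ∀ v → ∃[ k ] t k ≡ v
  exhausting⇒ t p v with k , _ , _ , _ , s , (e , _) ← until⇒ (p v) =
    k , trans (sym (s 0)) (equal refl e)

  exhausting⇐ : ∀ t → (∀ v → ∃[ k ] t k ≡ v) → Exhausting [] t
  exhausting⇐ t f v = let k , t≡ = f v in
    until⇐ k (λ _ → _) λ s → (_ , cong just (trans (s 0) t≡) , refl) , _

  -- The separating formulae on the test traces.

  Rise-0 : ∀ N → Rise N 0 ≡ d 0
  Rise-0 N = cong d (rise-low {N} z≤n)

  rise-pos : ∀ {N k} → 0 < k → k ≤ N → Rise N k ≢ Rise N 0
  rise-pos {N} 0<k k≤N e = <⇒≢ 0<k
    (trans (sym (rise-low {N} z≤n)) (trans (sym (d-injective e)) (rise-low k≤N)))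

  rise-inj : ∀ {N i j} → i < j → j ≤ N → Rise N i ≢ Rise N j
  rise-inj i<j j≤N e = <⇒≢ i<j (trans (sym (rise-low (≤-trans (<⇒≤ i<j) j≤N)))
    (trans (d-injective e) (rise-low j≤N)))

  Rise-over : ∀ N → Rise N (suc N) ≡ Rise N 0
  Rise-over N = cong d (trans (rise-high (n<1+n N)) (sym (rise-low {N} z≤n)))

  bump-low : ∀ {N j i k} → k < j → j ≤ N → bump N j i k ≡ k
  bump-low k<j j≤N = trans (bump-off (<⇒≢ k<j)) (rise-low (≤-trans (<⇒≤ k<j) j≤N))

  agree-Bump : ∀ {N j i m} → m ≤ j → Agree m (Rise N) (Bump N j i)
  agree-Bump m≤j k<m = cong d (bump-off (<⇒≢ (<-≤-trans k<m m≤j)))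

  recurs-Rise : ∀ N → lang recurs (Rise N)
  recurs-Rise N = recurs⇐ (Rise N) N (Rise-over N) (λ i<N → rise-pos z<s i<N)

  ¬recurs-d : ¬ lang recurs d
  ¬recurs-d p with _ , e ← recurs⇒ d p with () ← d-injective e

  repeats-Bump : ∀ {N p} → suc p < N → lang repeats (Bump N N (suc p))
  -- The datum at `suc p` is repeated at `N`, which lies `suc o` positions later.
  repeats-Bump {N} {p} p<N with o , refl ← m≤n⇒∃[o]m+o≡n p<N =
    repeats⇐ (Bump N N (suc p)) p o (λ e → 1+n≢0 (trans (sym low) (trans (d-injective e) (bump-low z<s ≤-refl))))
      (cong d (trans (cong (bump N N (suc p)) (cong (2 +_) (+-comm o p)))
        (trans (bump-at N N (suc p)) (sym low))))
    where
    low : bump N N (suc p) (suc p) ≡ suc p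
    low = bump-low p<N ≤-refl

  -- A second occurrence in the rising part contradicts injectivity, and one among the final zeros
  -- is the first datum.
  ¬repeats-Rise : ∀ N → ¬ lang repeats (Rise N)
  ¬repeats-Rise N p with k , q , t≢ , t≡ ← repeats⇒ (Rise N) p with rise-cases N (suc (suc q + k))
  ... | inj₁ (_ , j≤N) = rise-inj (s≤s (s≤s (m≤n+m k q))) j≤N (sym t≡)
  ... | inj₂ (e , _)   = t≢ (trans (sym t≡) (trans (cong d e) (sym (Rise-0 N))))

  turns-Rise : ∀ N → lang turns (Rise (suc N))
  turns-Rise N = turns⇐ (Rise (suc N)) N
    (λ i<N → rise-inj (s<s i<N) ≤-refl) (rise-pos z<s ≤-refl) (Rise-over (suc N))

  -- By the position of the supposed turn: at `N` its datum is not new, after `N` it is the first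
  -- datum, and before `N` its successor is nonzero.
  ¬turns-Bump : ∀ {N p} → suc p < N → ¬ lang turns (Bump N N (suc p))
  ¬turns-Bump {N} {p} p<N w
    with k , new , t≢ , t≡ ← turns⇒ (Bump N N (suc p)) w
    with <-cmp (suc k) N
  ... | tri≈ _ refl _ =
    new (s<s⁻¹ p<N) (cong d (trans (bump-low p<N ≤-refl) (sym (bump-at N N (suc p)))))
  ... | tri> _ k≢N N<k =
    t≢ (cong d (trans (bump-off k≢N) (trans (rise-high N<k)
      (sym (bump-low (<-trans z<s p<N) ≤-refl)))))
  ... | tri< k<N _ _ with m≤n⇒m<n∨m≡n k<N
  ...   | inj₁ k+1<N = 1+n≢0 (trans (sym (bump-low k+1<N ≤-refl))
                         (trans (d-injective t≡) (bump-low (<-trans z<s p<N) ≤-refl)))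
  ...   | inj₂ refl  = 1+n≢0 (trans (sym (bump-at N N (suc p)))
                         (trans (d-injective t≡) (bump-low z<s ≤-refl)))

  injects-Rise : ∀ N → lang injects (Rise N)
  injects-Rise N = injects⇐ (Rise N) N (Rise-over N) rise-inj

  -- The data at `suc p` and `j` coincide, which calls for a return of the first datum by position
  -- `j`; but the values at positions 1 to `j` are nonzero.
  ¬injects-Bump : ∀ {N j p} → suc p < j → j ≤ N → ¬ lang injects (Bump N j (suc p))
  ¬injects-Bump {N} {suc j} {p} (s<s p<j) j≤N w
    with k , k≤j , t≡ ← injects⇒ (Bump N (suc j) (suc p)) w p<j
      (cong d (trans (bump-low (s<s p<j) j≤N) (sym (bump-at N (suc j) (suc p)))))
    with k ≟ j
  ... | yes refl = 1+n≢0 (trans (sym (bump-at N (suc j) (suc p)))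
                     (trans (d-injective t≡) (bump-low z<s j≤N)))
  ... | no k≢j   = 1+n≢0 (trans (sym (bump-low (s<s (≤∧≢⇒< k≤j k≢j)) j≤N))
                     (trans (d-injective t≡) (bump-low z<s j≤N)))

  exhausting-d : Exhausting [] d
  exhausting-d = exhausting⇐ d λ v → Inverse.to 𝔻↔ℕ v , Inverse.strictlyInverseʳ 𝔻↔ℕ v

  ¬exhausting-Rise : ∀ N → ¬ Exhausting [] (Rise N)
  ¬exhausting-Rise N p with k , e ← exhausting⇒ (Rise N) p (d (suc N)) with rise-cases N k
  ... | inj₁ (r , k≤N) = <⇒≢ (s≤s k≤N) (trans (sym r) (d-injective e))
  ... | inj₂ (r , _)   = 1+n≢0 (trans (sym (d-injective e)) r)

  -- Membership in the fragments.

  Finite Recursive Alternating Full : Class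
  Finite      = HML (∃ᶜ ∷ ⟨⟩ᶜ ∷ ∨ᶜ ∷ [])
  Recursive   = HML (minᶜ ∷ ∃ᶜ ∷ ⟨⟩ᶜ ∷ ∨ᶜ ∷ [])
  Alternating = HML (minᶜ ∷ ∃ᶜ ∷ ⟨⟩ᶜ ∷ ∨ᶜ ∷ ∧ᶜ ∷ [])
  Full        = HML (minᶜ ∷ maxᶜ ∷ ∃ᶜ ∷ ∀ᶜ ∷ ⟨⟩ᶜ ∷ []ᶜ ∷ ∨ᶜ ∷ ∧ᶜ ∷ [])

  recurs∈ : (Recursive ∩ Det) recurs
  recurs∈ =
    ( ( (((_ , #0) , _) , (((_ , #0) , (_ , #1)) , _) , (((_ , #0) , (_ , #1)) , #0))
      , _ , λ ())
    , #1 , #2 , #0 , #3 , (#1 , #2 , _) , #1 , #2 , inj₁ #0) ,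
    det-intro (matchBody ⋆=x , _ , _ ,
      (y , _ , detBranch ⋆=x ∷ detBranch ⋆=x ∷ [] , ((λ v (p , q) → q p) ∷ []) ∷ [] ∷ []) ,
      (matchBody ⋆=x , _ , _) , matchBody ⋆=x , _ , _)

  repeats∈ : (Recursive ∩ Match) repeats
  repeats∈ =
    ( ( (((_ , #0) , _) , (((_ , #0) , (_ , #1)) , ((_ , #0) , _) , _ , #0) , _ , #0)
      , (_ , λ ()) , λ ())
    , #1 , #2 , #0 , #3 , (#1 , #2 , #0 , #3 , (#2 , _) , #2 , inj₁ #0) , #2 , inj₁ #0) ,
    match-intro (matchBody ⋆=x , _ , _ , _ , (matchBody ⋆=x , _) , _)

  turns∈ : Recursive turns
  turns∈ =
    ( (((_ , #0) , _) , (((_ , #0) , (_ , #1)) , (_ , #1) , _) , (_ , #0) , #0)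
    , _ , λ ())
    , #1 , #2 , #1 , #0 , #3 , (#2 , #2 , _) , #2 , inj₁ #0

  injects∈ : Alternating injects
  injects∈ =
    ( ( ((_ , #0) , _) , ((_ , #0) , _)
      , (_ , #0) , #0 , ((_ , #1) , _) , (_ , #0) , #0)
    , _ , (λ ()) , _ , λ ())
    , #1 , #2 , #0 , #3 , (#2 , _) , #1 , #2 , #4 , inj₁ #0 , #0 , #3 , (#2 , _) , #2 , inj₁ #0

  exhausts∈ : Full exhausts
  exhausts∈ = ((((_ , #0) , _) , _ , #0) , _ , λ ()) , built-from-all all-constructs exhausts

  finite⇒recursive : ∀ φ → Finite φ → Recursive φ
  finite⇒recursive φ (μ , p) = μ , built-from-mono there φ p

  recursive⇒alternating : ∀ φ → Recursive φ → Alternating φ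
  recursive⇒alternating φ (μ , p) = μ , existential⇒positive φ p

  recursive⇒positive : ∀ φ → Recursive φ → Positive φ
  recursive⇒positive φ p = proj₂ (recursive⇒alternating φ p)

  alternating⇒full : ∀ φ → Alternating φ → Full φ
  alternating⇒full φ (μ , _) = μ , built-from-all all-constructs φ

  -- The strict inclusions.

  -- A formula that reads `n` data cannot tell `Rise n` from the enumeration `d`, whose first datum
  -- never returns.
  finite-det⊏det : Finite ∩ Det ⊏ Recursive ∩ Det
  finite-det⊏det =
    inclusion (λ φ (p , r) → (finite⇒recursive φ p , r) , positive φ (p , r)) ,
    λ sub → let
      ψ , ((_ , finite) , _) , to , from = express positive sub recurs (eval recurs ∅) recurs∈
        (eval-correct recurs (recursive⇒positive recurs (proj₁ recurs∈)))
      n , f = finite-depth ψ finite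
    in ¬recurs-d (from (f (λ k<n → cong d (sym (rise-low (<⇒≤ k<n)))) (to (recurs-Rise n))))
    where
    positive : ∀ φ → (Finite ∩ Det) φ → Positive φ
    positive φ (p , _) = recursive⇒positive φ (finite⇒recursive φ p)

  module _ (ψ : Formula) (closed : Closed ψ) (ex : Existential ψ) where

    private
      K N : ℕ
      K = rank ψ
      -- A fresh index from 1 to `suc (length support)` is at most `suc K`, hence below `N`.
      N = 2 + K

      Seen : Pred 𝔻 0ℓ
      Seen v = ∃[ k ] k < N × v ≡ d k

      unseen : ¬ Seen (d N)
      unseen (k , k<N , e) = <⇒≢ k<N (sym (d-injective e))

    -- All these bumps share their first `N` data, so the residual taken from `Bump N N 1` is
    -- complete for each of them. Thus `i` may be chosen outside its support, and swapping `i` with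
    -- `N` turns the suffix of that bump into that of the rise.
    det-confuses : Det ψ → (∀ {p} → suc p < N → lang ψ (Bump N N (suc p))) →
                   lang ψ (Rise N)
    det-confuses ψ-det bumps = confuse (fresh support 1)
      where
      open Residuals K det Seen (λ ())
      open Residual (residual₀ ψ closed ex ψ-det ≤-refl N {Bump N N 1}
        (λ k<N → _ , k<N , cong d (bump-low k<N ≤-refl)) (bumps (s≤s (s≤s z≤n))))
      confuse : ∃[ i ] 1 ≤ i × i ≤ suc (length support) × d i ∉ support → lang ψ (Rise N)
      confuse (suc p , _ , p≤ , p∉) =
        sound (λ k<N → sym (agree-Bump ≤-refl k<N))
          (supported (swap-injective _ _) (swap-fixes p∉ (unseen ∘ allowed))
            (λ k → rise-swap z<s p<N ≤-refl (<-≤-trans p<N (m≤m+n N k)))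
            (complete refl
              (λ k<N → trans (agree-Bump ≤-refl k<N) (sym (agree-Bump ≤-refl k<N)))
              (bumps p<N)))
        where
        p<N : suc p < N
        p<N = s≤s (≤-trans p≤ (s≤s small))

    -- The support consists of data from the prefix and so omits `N`; swapping `N` with an `i`
    -- outside the support preserves acceptance of the suffix.
    match-confuses : Match ψ → lang ψ (Rise N) →
                     ∃[ p ] suc p < N × lang ψ (Bump N N (suc p))
    match-confuses ψ-match rise = confuse (fresh support 1)
      where
      open Residuals K match Seen (λ ())
      open Residual (residual₀ ψ closed ex ψ-match ≤-refl N {Rise N}
        (λ k<N → _ , k<N , cong d (rise-low (<⇒≤ k<N))) rise)
      confuse : ∃[ i ] 1 ≤ i × i ≤ suc (length support) × d i ∉ support →
                ∃[ p ] suc p < N × lang ψ (Bump N N (suc p))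
      confuse (suc p , _ , p≤ , p∉) = p , p<N ,
        sound (agree-Bump ≤-refl)
          (supported (swap-injective _ _) (swap-fixes p∉ (unseen ∘ allowed))
            (λ k → bump-swap z<s p<N ≤-refl (<-≤-trans p<N (m≤m+n N k))) holds)
        where
        p<N : suc p < N
        p<N = s≤s (≤-trans p≤ (s≤s small))

    -- Guessed data may lie in the future, so `j` has to avoid the support as well; the rise goes up
    -- to `N + K` to leave `K + 1` candidates from `N` on.
    existential-confuses : lang ψ (Rise (N + K)) →
      ∃[ p ] ∃[ j ] suc p < j × j ≤ N + K × lang ψ (Bump (N + K) j (suc p))
    existential-confuses rise = confuse (fresh support 1) (fresh support N)
      where
      open Residuals K free U _
      open Residual (residual₀ ψ closed ex _ ≤-refl N {Rise (N + K)} _ rise)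
      confuse : ∃[ i ] 1 ≤ i × i ≤ suc (length support) × d i ∉ support →
                ∃[ j ] N ≤ j × j ≤ N + length support × d j ∉ support →
                ∃[ p ] ∃[ j ] suc p < j × j ≤ N + K × lang ψ (Bump (N + K) j (suc p))
      confuse (suc p , _ , p≤ , p∉) (j , N≤j , j≤ , j∉) = p , j , p<j , j≤N+K ,
        sound (agree-Bump N≤j)
          (supported (swap-injective _ _) (swap-fixes p∉ j∉)
            (λ k → bump-swap z<s p<j j≤N+K (<-≤-trans p<N (m≤m+n N k))) holds)
        where
        p<N : suc p < N
        p<N = s≤s (≤-trans p≤ (s≤s small))
        p<j : suc p < j
        p<j = <-≤-trans p<N N≤j
        j≤N+K : j ≤ N + K
        j≤N+K = ≤-trans j≤ (+-monoʳ-≤ N small)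

  det⊏match : Recursive ∩ Det ⊏ Recursive ∩ Match
  det⊏match =
    inclusion (λ φ (p , r) → (p , proj₁ r) , recursive⇒positive φ p) ,
    λ sub → let
      ψ , (((closed , _) , ex) , ψ-det) , to , from = express
        (λ φ (p , _) → recursive⇒positive φ p) sub repeats (eval repeats ∅) repeats∈
        (eval-correct repeats (recursive⇒positive repeats (proj₁ repeats∈)))
    in ¬repeats-Rise (2 + rank ψ)
         (from (det-confuses ψ closed ex ψ-det (λ p<N → to (repeats-Bump p<N))))

  match⊏recursive : Recursive ∩ Match ⊏ Recursive
  match⊏recursive =
    inclusion (λ φ (p , _) → p , recursive⇒positive φ p) ,
    λ sub → let
      ψ , (((closed , _) , ex) , ψ-match) , to , from = express
        (λ φ (p , _) → recursive⇒positive φ p) sub turns (eval turns ∅) turns∈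
        (eval-correct turns (recursive⇒positive turns turns∈))
      _ , p<N , bump = match-confuses ψ closed ex ψ-match (to (turns-Rise (1 + rank ψ)))
    in ¬turns-Bump p<N (from bump)

  recursive⊏alternating : Recursive ⊏ Alternating
  recursive⊏alternating =
    inclusion (λ φ p → recursive⇒alternating φ p , recursive⇒positive φ p) ,
    λ sub → let
      ψ , ((closed , _) , ex) , to , from = express
        recursive⇒positive sub injects (eval injects ∅) injects∈
        (eval-correct injects (proj₂ injects∈))
      _ , _ , p<j , j≤N , bump =
        existential-confuses ψ closed ex (to (injects-Rise (2 + rank ψ + rank ψ)))
    in ¬injects-Bump p<j j≤N (from bump)

  -- Openness would let a finite prefix of `d` force every datum to occur, yet `Rise n` shares that
  -- prefix and omits `suc n`.
  alternating⊏full : Alternating ⊏ Full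
  alternating⊏full =
    inclusion (λ φ p → alternating⇒full φ p , proj₂ p) ,
    λ sub → let
      ψ , _ , to , from = express (λ _ → proj₂) sub exhausts Exhausting exhausts∈ exhausts-correct
      n , f = open-eval ψ (λ _ ()) (to exhausting-d)
    in ¬exhausting-Rise n (from (f (λ k<n → cong d (rise-low (<⇒≤ k<n)))))

theorem60 : (𝔻 : Set) → 𝔻 ↔ ℕ →
    let open Semantics 𝔻 in
    (HML (∃ᶜ ∷ ⟨⟩ᶜ ∷ ∨ᶜ ∷ []) ∩ Det ⊏ HML (minᶜ ∷ ∃ᶜ ∷ ⟨⟩ᶜ ∷ ∨ᶜ ∷ []) ∩ Det)
    × (HML (minᶜ ∷ ∃ᶜ ∷ ⟨⟩ᶜ ∷ ∨ᶜ ∷ []) ∩ Det ⊏ HML (minᶜ ∷ ∃ᶜ ∷ ⟨⟩ᶜ ∷ ∨ᶜ ∷ []) ∩ Match)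
    × (HML (minᶜ ∷ ∃ᶜ ∷ ⟨⟩ᶜ ∷ ∨ᶜ ∷ []) ∩ Match ⊏ HML (minᶜ ∷ ∃ᶜ ∷ ⟨⟩ᶜ ∷ ∨ᶜ ∷ []))
    × (HML (minᶜ ∷ ∃ᶜ ∷ ⟨⟩ᶜ ∷ ∨ᶜ ∷ []) ⊏ HML (minᶜ ∷ ∃ᶜ ∷ ⟨⟩ᶜ ∷ ∨ᶜ ∷ ∧ᶜ ∷ []))
    × (HML (minᶜ ∷ ∃ᶜ ∷ ⟨⟩ᶜ ∷ ∨ᶜ ∷ ∧ᶜ ∷ []) ⊏ HML (minᶜ ∷ maxᶜ ∷ ∃ᶜ ∷ ∀ᶜ ∷ ⟨⟩ᶜ ∷ []ᶜ ∷ ∨ᶜ ∷ ∧ᶜ ∷ []))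
    × (HML (minᶜ ∷ maxᶜ ∷ ∃ᶜ ∷ ∀ᶜ ∷ ⟨⟩ᶜ ∷ []ᶜ ∷ ∨ᶜ ∷ ∧ᶜ ∷ []) ≐ μHML)
theorem60 𝔻 𝔻↔ℕ =
  finite-det⊏det , det⊏match , match⊏recursive , recursive⊏alternating , alternating⊏full ,
  -- With every construct available, `BuiltFrom` holds of all formulae, which gives the final
  -- equality of classes.
  proj₁ , λ {φ} p → p , built-from-all all-constructs φ
  where open Separation 𝔻 𝔻↔ℕ
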